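{- For all $TCCS^m$ processes $P$ and $Q$: $P\approx_{\mathsf{Eq}}Q$ if and only if $\mathcal L_{\mathsf{Eq}}(P)=\mathcal L_{\mathsf{Eq}}(Q)$.
   Context: LANGUAGE. $\mathsf{Act}$ is an infinite set of actions with CCS complementation ($\bar{\bar a}=a$); $\tau\notin\mathsf{Act}$; $\mu$ ranges over $\mathsf{Act}\cup\{\tau\}$. Transaction names: $\mathsf{TrN}=\mathsf{inTrN}\uplus\mathsf{exTrN}$ (internal and external names, both infinite). Terms: $P,Q::=\sum_{i\in J}\mu_i.P_i$ ($J$ countable; $\mathbf 0$ is the empty sum) $\mid P\mid Q\mid\nu a.P\mid X\mid\mathrm{rec}X.P\mid[\![P\triangleright_kQ]\!]$ (running transaction named $k$) $\mid\mathrm{co}\mid[\![P\blacktriangleright Q]\!]$ (dormant transaction). $ftn(o)$ is the set of transaction names in $o$; $o\,\sharp\,o'$ means no transaction name of $o$ occurs in $o'$. A process is a well-formed term: (1) it is closed (no free process variables); (2) $ftn$ of it is finite; and for all subterms $[\![P_1\triangleright_kP_1']\!]$, $[\![P_2\blacktriangleright P_2']\!]$, $\sum\mu_i.Q_i$, $\mathrm{rec}X.R$: (3) $P_1,P_1',P_2,P_2',Q_i,R$ contain no transaction names; (4) $P_1,P_2,Q_i$ contain no dormant transactions; (5) $P_1,P_2$ are closed. PROCESS TRANSITIONS. $P\xrightarrow{\alpha}_\sigma Q$ with $\alpha\in\{a,\tau,k(\tau),k(a)\}$ and $\sigma$ a name substitution $\tilde k\mapsto l$ (domain the finite tuple $\tilde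 k$, possibly empty, range $\{l\}$; $\varepsilon$ alone is the empty substitution). Rules (symmetric ones omitted): - $\sum\mu_i.P_i\xrightarrow{\mu_j}_\varepsilon P_j$; - if $P\xrightarrow{a}_\varepsilon P'$ and $Q\xrightarrow{\bar a}_\varepsilon Q'$ then $P\mid Q\xrightarrow{\tau}_\varepsilon P'\mid Q'$; - $\mathrm{rec}X.P\xrightarrow{\tau}_\varepsilon P[\mathrm{rec}X.P/X]$; - if $\mu_j=a$ then $\sum\mu_i.P_i\xrightarrow{k(a)}_{\varepsilon\mapsto k}[\![P_j\mid\mathrm{co}\triangleright_k\sum\mu_i.P_i]\!]$; - if $P\xrightarrow{\mu}_\varepsilon P'$ and $k\,\sharp\,l$ then $[\![P\triangleright_lQ]\!]\xrightarrow{k(\mu)}_{l\mapsto k}[\![P'\triangleright_kQ]\!]$; - if $P\xrightarrow{k(a)}_{\sigma_1}P'$, $Q\xrightarrow{k(\bar a)}_{\sigma_2}Q'$, $\sigma_i=\tilde l_i\mapsto k$, then $P\mid Q\xrightarrow{k(\tau)}_{(\tilde l_1,\tilde l_2)\mapsto k}P'\sigma_2\mid Q'\sigma_1$; - if $P\xrightarrow{\alpha}_\sigma P'$ and $range(\sigma)\,\sharp\,Q$ then $P\mid Q\xrightarrow{\alpha}_\sigma P'\mid Q\sigma$; - if $P\xrightarrow{\alpha}_\sigma P'$ and $a$ does not occur in $\alpha$ then $\nu a.P\xrightarrow{\alpha}_\sigma\nu a.P'$. Reconfiguration transitions $P\xrightarrow{\beta}Q$, $\beta\in\{\mathrm{co}\,k,\mathrm{ab}\,k,\mathrm{new}\,k\}$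 (symmetric rules omitted): - if $P\equiv\mathrm{co}\mid P''$ for some $P''$ and $P\rightsquigarrow_{\mathrm{co}}P'$ then $[\![P\triangleright_kQ]\!]\xrightarrow{\mathrm{co}\,k}P'$; - $[\![P\blacktriangleright Q]\!]\xrightarrow{\mathrm{new}\,k}[\![P\triangleright_kQ]\!]$; - $[\![P\triangleright_kQ]\!]\xrightarrow{\mathrm{ab}\,k}Q$; - for $\beta=\mathrm{co}\,k$ or $\mathrm{ab}\,k$: if $P\xrightarrow{\beta}P'$ and $Q\xrightarrow{\beta}Q'$ then $P\mid Q\xrightarrow{\beta}P'\mid Q'$; - if $P\xrightarrow{\beta}P'$ and $\beta\,\sharp\,Q$ then $P\mid Q\xrightarrow{\beta}P'\mid Q$; - if $P\xrightarrow{\beta}P'$ then $\nu a.P\xrightarrow{\beta}\nu a.P'$. Here $\equiv$ is standard CCS structural equivalence extended to transactions, and $\rightsquigarrow_{\mathrm{co}}$ is given by: $\mathrm{co}\rightsquigarrow_{\mathrm{co}}\mathbf 0$; sums, variables, $\mathrm{rec}X.P$ and $[\![P\blacktriangleright Q]\!]$ are related to themselves; it is compatible with $\nu a.-$ and $-\mid-$. EXTENDED CONFIGURATIONS. $I$ is a countable index set. An extended configuration is $\langle E;H\bullet P\rangle$ with $P$ a process, $E$ an equivalence relation over a finite subset of $\mathsf{TrN}$, and $H$ a finite partial function from $I$ to $\{k(a),k(\mathrm{ab}),k(\mathrm{co})\mid k\in\mathsf{exTrN},a\in\mathsf{Act}\}$. Let $H^{\mathrm{trn}}(i)$ be the name used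 in $H(i)$, $H^{\mathrm{trn}}$ the set of all these, and $\mathrm{Hasco}(H)=\{k\mid\exists i.\,H(i)=k(\mathrm{co})\}$. It is required that: (i) $H^{\mathrm{trn}}(i)=H^{\mathrm{trn}}(j)$ implies $i=j$; (ii) for $k\in\mathsf{exTrN}$, $k\,E\,k$ iff $k\in H^{\mathrm{trn}}$, and $k\,E\,k'$ implies ($k\in\mathrm{Hasco}(H)$ iff $k'\in\mathrm{Hasco}(H)$); (iii) $ftn(P)\cap\mathrm{Hasco}(H)=\emptyset$; (iv) $k\,E\,k'$ and $k,k'\in ftn(P)$ imply $k=k'$. Convention: external names of a configuration are those in its history, i.e. $ftn(P)\cap\mathsf{exTrN}\subseteq H^{\mathrm{trn}}$; in particular a process $P$ viewed as $\langle\emptyset;\varepsilon\bullet P\rangle$ ($\varepsilon$ the empty history) has $ftn(P)\subseteq\mathsf{inTrN}$. "$H,k(a)$" denotes $H$ extended at a new index. For $\sigma=\tilde k\mapsto l$, $\sigma(E)$ is the smallest equivalence relation $F\supseteq E$ with $l\,F\,l$ and $k\,F\,l$ for all $k\in dom(\sigma)$. $(E;H)\setminus_{\mathrm{co}}k$ (resp. $\setminus_{\mathrm{ab}}k$) keeps $E$ and, for every $k'\,E\,k$, changes each $k'(a)$ in $H$ to $k'(\mathrm{co})$ (resp. $k'(\mathrm{ab})$). With $\Delta=E;H$, the extended transitions (labels $\zeta\in\{\tau,k(a)\}$) between extended configurations are: - $\langle\Delta\bullet P\rangle\xrightarrow{\tau}_e\langle\Delta\bullet Q\rangle$ if $P\xrightarrow{\tau}_\varepsilon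 Q$; - $\xrightarrow{\tau}_e\langle\sigma(E);H\bullet Q\rangle$ if $P\xrightarrow{k(\tau)}_\sigma Q$, $k\,\sharp\,E,H$, $k\in\mathsf{inTrN}$; - $\xrightarrow{\tau}_e\langle\Delta\bullet Q\rangle$ if $P\xrightarrow{\mathrm{new}\,k}Q$, $k\,\sharp\,\Delta$, $k\in\mathsf{inTrN}$; - $\xrightarrow{\tau}_e\langle\Delta\setminus_{\mathrm{co}}k\bullet Q\rangle$ if $P\xrightarrow{\mathrm{co}\,k}Q$; - $\xrightarrow{\tau}_e\langle\Delta\setminus_{\mathrm{ab}}k\bullet Q\rangle$ if $P\xrightarrow{\mathrm{ab}\,k}Q$; - $\xrightarrow{k(a)}_e\langle\sigma(E);H,k(a)\bullet Q\rangle$ if $P\xrightarrow{k(a)}_\sigma Q$, $k\,\sharp\,E,H$, $k\in\mathsf{exTrN}$; - $\xrightarrow{k(a)}_e\langle E,(k,k);H,k(\mathrm{ab})\bullet P\rangle$ if $k\,\sharp\,E,H,P$, $k\in\mathsf{exTrN}$. $\stackrel{\tau}{\Rightarrow}_e$ is $(\xrightarrow{\tau}_e)^*$ and $\stackrel{\zeta}{\Rightarrow}_e$ is $\stackrel{\tau}{\Rightarrow}_e\xrightarrow{\zeta}_e\stackrel{\tau}{\Rightarrow}_e$ otherwise. $\mathsf{Eq}$-BISIMULATION. For $\mathcal C=\langle E;H\bullet P\rangle$ and $k,k'\in\mathsf{exTrN}$ write $\mathcal C\models k=_{\mathrm{co}}k'$ if $k,k'\in\mathrm{Hasco}(H)$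 and $k\,E\,k'$. $\mathcal C_1\,\mathsf{Eq}\,\mathcal C_2$ means that for all $k,k'\in\mathsf{exTrN}$: $\mathcal C_1\models k=_{\mathrm{co}}k'$ iff $\mathcal C_2\models k=_{\mathrm{co}}k'$. A relation $\mathcal R$ on extended configurations is an $\mathsf{Eq}$-bisimulation if $\mathcal C_1\mathcal R\mathcal C_2$ implies: $\mathcal C_1\,\mathsf{Eq}\,\mathcal C_2$; and if $\mathcal C_1\stackrel{\zeta}{\Rightarrow}_e\mathcal C_1'$ with $\zeta\,\sharp\,\mathcal C_2$ then $\mathcal C_2\stackrel{\zeta}{\Rightarrow}_e\mathcal C_2'$ for some $\mathcal C_2'$ with $\mathcal C_1'\mathcal R\mathcal C_2'$; and conversely. $\approx_{\mathsf{Eq}}$ is the largest one; $P\approx_{\mathsf{Eq}}Q$ means $\langle\emptyset;\varepsilon\bullet P\rangle\approx_{\mathsf{Eq}}\langle\emptyset;\varepsilon\bullet Q\rangle$. LOGIC $\mathcal L_{\mathsf{Eq}}$. $\mathsf{Var}$ is a countable set of variables disjoint from $\mathsf{exTrN}$. Formulae: $\phi::=\langle\tau\rangle\phi\mid\langle x(a)\rangle\phi\mid\neg\phi\mid\bigwedge_{i\in K}\phi_i$ ($K$ an arbitrary index set) $\mid v_1=_{\mathrm{co}}v_2$, with $x\in\mathsf{Var}$, $a\in\mathsf{Act}$, $v_i\in\mathsf{exTrN}\cup\mathsf{Var}$; $\langle x(a)\rangle\phi$ binds $x$ in $\phi$; closed formulae have no free variables. Satisfaction for closed formulae: for $\mathcal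 C=\langle E;H\bullet P\rangle$ and $k,k'\in\mathsf{exTrN}$, $\mathcal C\models k=_{\mathrm{co}}k'$ iff $k,k'\in\mathrm{Hasco}(H)$ and $k\,E\,k'$; $\mathcal C\models\langle\tau\rangle\phi$ iff $\mathcal C\stackrel{\tau}{\Rightarrow}_e\mathcal C'$ with $\mathcal C'\models\phi$ for some $\mathcal C'$; $\mathcal C\models\langle x(a)\rangle\phi$ iff there is a cofinite $N\subseteq\mathsf{exTrN}$ such that for all $l\in N$ there is $\mathcal C'$ with $\mathcal C\stackrel{l(a)}{\Rightarrow}_e\mathcal C'$ and $\mathcal C'\models\phi[l/x]$; conjunction and negation are standard. $\mathcal L_{\mathsf{Eq}}(P)$ is the set of closed $\phi$ with $\langle\emptyset;\varepsilon\bullet P\rangle\models\phi$. -}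

module Defs where

open import Data.Bool using (Bool; not; if_then_else_)
open import Data.Empty using (⊥; ⊥-elim)
open import Data.Fin using (Fin; zero; suc)
open import Data.List using (List; []; _∷_; _++_)
open import Data.List.Membership.Propositional using (_∈_; _∉_)
import Data.List.Membership.DecPropositional as DecMembership
open import Data.Maybe using (Maybe; just; nothing)
import Data.Maybe as Maybe
open import Data.Nat using (ℕ; zero; suc)
open import Data.Product using (_×_; _,_; Σ-syntax; ∃-syntax)
open import Data.Product.Properties using () renaming (≡-dec to ×-≡-dec)
open import Data.Sum using (_⊎_; inj₁; inj₂)
open import Data.Sum.Properties using () renaming (≡-dec to ⊎-≡-dec)
open import Data.Unit using (⊤)
import Data.Vec.Functional as Vector
open import Function using (_∘_; _⇔_; mk⇔; _↣_; _↔_; Equivalence; Inverse)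
open import Level using (0ℓ)
open import Relation.Binary.Core using (Rel)
open import Relation.Binary.Definitions using (DecidableEquality)
open import Relation.Binary.Structures using (IsPartialEquivalence)
open import Relation.Binary.PropositionalEquality
  using (_≡_; _≢_; _≗_; refl; sym; subst₂)
open import Relation.Binary.Construct.Closure.ReflexiveTransitive using (Star)
open import Relation.Binary.Construct.Closure.SymmetricTransitive using (Plus⇔)
open import Relation.Nullary using (¬_; does)
open import Relation.Unary using (Pred)

record Signature : Set₁ where
  field
    Act            : Set
    bar            : Act → Act
    bar-involutive : ∀ a → bar (bar a) ≡ a
    Act-infinite   : ℕ ↣ Act
    InTrN          : Set
    ExTrN          : Set
    InTrN-infinite : ℕ ↣ InTrN
    ExTrN-infinite : ℕ ↣ ExTrN
    -- Classically every set has these; they let renamings compute.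
    _≟ᵢ_           : DecidableEquality InTrN
    _≟ₑ_           : DecidableEquality ExTrN

module TCCS (S : Signature) where
  open Signature S

  TrN : Set
  TrN = InTrN ⊎ ExTrN

  _≟_ : DecidableEquality TrN
  _≟_ = ⊎-≡-dec _≟ᵢ_ _≟ₑ_

  -- Terms are taken up to α-conversion: `Term n m` has n channels bound
  -- by enclosing ν's and m process variables bound by enclosing rec's.
  -- A ν binds an action together with its complement, so an occurrence
  -- of a bound channel carries a polarity.
  data Action (n : ℕ) : Set where
    free  : Act → Action n
    bound : Fin n → Bool → Action n

  co-action : ∀ {n} → Action n → Action n
  co-action (free a)    = free (bar a)
  co-action (bound i p) = bound i (not p)

  data Prefix (n : ℕ) : Set where
    τ   : Prefix n
    vis : Action n → Prefix n

  -- The countable index sets, up to bijection.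
  data Card : Set where
    fin : ℕ → Card
    ω   : Card

  Idx : Card → Set
  Idx (fin n) = Fin n
  Idx ω       = ℕ

  infixr 6 _∥_

  -- The first components of transactions are closed, as well-formedness
  -- demands; WellFormed below imposes the remaining conditions.
  data Term (n : ℕ) (m : ℕ) : Set where
    sum        : (J : Card) → (Idx J → Prefix n) → (Idx J → Term n m) → Term n m
    _∥_        : Term n m → Term n m → Term n m
    ν          : Term (suc n) m → Term n m
    var        : Fin m → Term n m
    rec        : Term n (suc m) → Term n m
    ⟦_▷[_]_⟧   : Term n 0 → TrN → Term n m → Term n m
    co         : Term n m
    ⟦_▶_⟧      : Term n 0 → Term n m → Term n m

  𝟎 : ∀ {n m} → Term n m
  𝟎 = sum (fin 0) (λ ()) (λ ())

  data _∈ftn_ {n m} (k : TrN) : Term n m → Set where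
    in-sum     : ∀ {J μ P} (i : Idx J) → k ∈ftn P i → k ∈ftn sum J μ P
    in-∥ˡ      : ∀ {P Q} → k ∈ftn P → k ∈ftn (P ∥ Q)
    in-∥ʳ      : ∀ {P Q} → k ∈ftn Q → k ∈ftn (P ∥ Q)
    in-ν       : ∀ {P} → k ∈ftn P → k ∈ftn ν P
    in-rec     : ∀ {P} → k ∈ftn P → k ∈ftn rec P
    here-▷     : ∀ {P Q} → k ∈ftn ⟦ P ▷[ k ] Q ⟧
    in-▷ˡ      : ∀ {P l Q} → k ∈ftn P → k ∈ftn ⟦ P ▷[ l ] Q ⟧
    in-▷ʳ      : ∀ {P l Q} → k ∈ftn Q → k ∈ftn ⟦ P ▷[ l ] Q ⟧
    in-▶ˡ      : ∀ {P Q} → k ∈ftn P → k ∈ftn ⟦ P ▶ Q ⟧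
    in-▶ʳ      : ∀ {P Q} → k ∈ftn Q → k ∈ftn ⟦ P ▶ Q ⟧

  data HasDormant {n m} : Term n m → Set where
    here-▶     : ∀ {P Q} → HasDormant ⟦ P ▶ Q ⟧
    in-sum     : ∀ {J μ P} (i : Idx J) → HasDormant (P i) → HasDormant (sum J μ P)
    in-∥ˡ      : ∀ {P Q} → HasDormant P → HasDormant (P ∥ Q)
    in-∥ʳ      : ∀ {P Q} → HasDormant Q → HasDormant (P ∥ Q)
    in-ν       : ∀ {P} → HasDormant P → HasDormant (ν P)
    in-rec     : ∀ {P} → HasDormant P → HasDormant (rec P)
    in-▷ˡ      : ∀ {P k Q} → HasDormant P → HasDormant ⟦ P ▷[ k ] Q ⟧
    in-▷ʳ      : ∀ {P k Q} → HasDormant Q → HasDormant ⟦ P ▷[ k ] Q ⟧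

  NoTrN NoDormant : ∀ {n m} → Term n m → Set
  NoTrN P     = ∀ k → ¬ k ∈ftn P
  NoDormant P = ¬ HasDormant P

  WellFormed : ∀ {n m} → Term n m → Set
  WellFormed (sum J μ P)    = ∀ i → NoTrN (P i) × NoDormant (P i) × WellFormed (P i)
  WellFormed (P ∥ Q)        = WellFormed P × WellFormed Q
  WellFormed (ν P)          = WellFormed P
  WellFormed (var X)        = ⊤
  WellFormed (rec P)        = NoTrN P × WellFormed P
  WellFormed ⟦ P ▷[ k ] Q ⟧ =
    NoTrN P × NoTrN Q × NoDormant P × WellFormed P × WellFormed Q
  WellFormed co             = ⊤
  WellFormed ⟦ P ▶ Q ⟧      =
    NoTrN P × NoTrN Q × NoDormant P × WellFormed P × WellFormed Q

  record IsProcess (P : Term 0 0) : Set where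
    field
      ftn-finite  : ∃[ ks ] (∀ k → k ∈ftn P → k ∈ ks)
      well-formed : WellFormed P

  renameA : ∀ {n n′} → (Fin n → Fin n′) → Action n → Action n′
  renameA ρ (free a)    = free a
  renameA ρ (bound i p) = bound (ρ i) p

  renameP : ∀ {n n′} → (Fin n → Fin n′) → Prefix n → Prefix n′
  renameP ρ τ       = τ
  renameP ρ (vis a) = vis (renameA ρ a)

  lift : ∀ {n n′} → (Fin n → Fin n′) → Fin (suc n) → Fin (suc n′)
  lift ρ zero    = zero
  lift ρ (suc i) = suc (ρ i)

  renameCh : ∀ {n n′ m} → (Fin n → Fin n′) → Term n m → Term n′ m
  renameCh ρ (sum J μ P)    = sum J (renameP ρ ∘ μ) (λ i → renameCh ρ (P i))
  renameCh ρ (P ∥ Q)        = renameCh ρ P ∥ renameCh ρ Q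
  renameCh ρ (ν P)          = ν (renameCh (lift ρ) P)
  renameCh ρ (var X)        = var X
  renameCh ρ (rec P)        = rec (renameCh ρ P)
  renameCh ρ ⟦ P ▷[ k ] Q ⟧ = ⟦ renameCh ρ P ▷[ k ] renameCh ρ Q ⟧
  renameCh ρ co             = co
  renameCh ρ ⟦ P ▶ Q ⟧      = ⟦ renameCh ρ P ▶ renameCh ρ Q ⟧

  renameVar : ∀ {n m m′} → (Fin m → Fin m′) → Term n m → Term n m′
  renameVar ρ (sum J μ P)    = sum J μ (λ i → renameVar ρ (P i))
  renameVar ρ (P ∥ Q)        = renameVar ρ P ∥ renameVar ρ Q
  renameVar ρ (ν P)          = ν (renameVar ρ P)
  renameVar ρ (var X)        = var (ρ X)
  renameVar ρ (rec P)        = rec (renameVar (lift ρ) P)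
  renameVar ρ ⟦ P ▷[ k ] Q ⟧ = ⟦ P ▷[ k ] renameVar ρ Q ⟧
  renameVar ρ co             = co
  renameVar ρ ⟦ P ▶ Q ⟧      = ⟦ P ▶ renameVar ρ Q ⟧

  liftS : ∀ {n m m′} → (Fin m → Term n m′) → Fin (suc m) → Term n (suc m′)
  liftS θ zero    = var zero
  liftS θ (suc X) = renameVar suc (θ X)

  substVar : ∀ {n m m′} → (Fin m → Term n m′) → Term n m → Term n m′
  substVar θ (sum J μ P)    = sum J μ (λ i → substVar θ (P i))
  substVar θ (P ∥ Q)        = substVar θ P ∥ substVar θ Q
  substVar θ (ν P)          = ν (substVar (renameCh suc ∘ θ) P)
  substVar θ (var X)        = θ X
  substVar θ (rec P)        = rec (substVar (liftS θ) P)
  substVar θ ⟦ P ▷[ k ] Q ⟧ = ⟦ P ▷[ k ] substVar θ Q ⟧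
  substVar θ co             = co
  substVar θ ⟦ P ▶ Q ⟧      = ⟦ P ▶ substVar θ Q ⟧

  unfold : ∀ {n} → Term n 1 → Term n 0
  unfold P = substVar (λ _ → rec P) P

  data NameSubst : Set where
    ε   : NameSubst
    _↦_ : List TrN → TrN → NameSubst

  dom : NameSubst → List TrN
  dom ε        = []
  dom (ks ↦ l) = ks

  data _∈range_ (k : TrN) : NameSubst → Set where
    is-range : ∀ {ks} → k ∈range (ks ↦ k)

  open DecMembership _≟_ using (_∈?_)

  applyN : NameSubst → TrN → TrN
  applyN ε        k = k
  applyN (ks ↦ l) k = if does (k ∈? ks) then l else k

  -- In a well-formed term no transaction name occurs in a sum, in a rec,
  -- or in either part of a transaction, so only the names of the
  -- outermost running transactions are affected.
  _[_] : ∀ {n m} → Term n m → NameSubst → Term n m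
  (sum J μ P)    [ σ ] = sum J μ P
  (P ∥ Q)        [ σ ] = (P [ σ ]) ∥ (Q [ σ ])
  (ν P)          [ σ ] = ν (P [ σ ])
  (var X)        [ σ ] = var X
  (rec P)        [ σ ] = rec P
  ⟦ P ▷[ k ] Q ⟧ [ σ ] = ⟦ P ▷[ applyN σ k ] Q ⟧
  co             [ σ ] = co
  ⟦ P ▶ Q ⟧      [ σ ] = ⟦ P ▶ Q ⟧

  data Label (n : ℕ) : Set where
    plain : Prefix n → Label n
    _⟨_⟩  : TrN → Prefix n → Label n

  wkLabel : ∀ {n} → Label n → Label (suc n)
  wkLabel (plain μ) = plain (renameP suc μ)
  wkLabel (k ⟨ μ ⟩) = k ⟨ renameP suc μ ⟩

  infix 4 _─[_∣_]→_ _─⟪_⟫→_ _≡ₛ_ _⇝co_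

  data _─[_∣_]→_ {n} : Term n 0 → Label n → NameSubst → Term n 0 → Set where

    sum-step : ∀ {J μ P} (j : Idx J) →
      sum J μ P ─[ plain (μ j) ∣ ε ]→ P j

    -- The mirror image is the instance at `co-action a`.
    sync : ∀ {P P′ Q Q′ a} →
      P ─[ plain (vis a) ∣ ε ]→ P′ →
      Q ─[ plain (vis (co-action a)) ∣ ε ]→ Q′ →
      P ∥ Q ─[ plain τ ∣ ε ]→ P′ ∥ Q′

    rec-step : ∀ {P} →
      rec P ─[ plain τ ∣ ε ]→ unfold P

    sum-join : ∀ {J μ P a} (k : TrN) (j : Idx J) → μ j ≡ vis a →
      sum J μ P ─[ k ⟨ vis a ⟩ ∣ [] ↦ k ]→ ⟦ P j ∥ co ▷[ k ] sum J μ P ⟧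

    run-step : ∀ {P P′ Q k l μ} →
      P ─[ plain μ ∣ ε ]→ P′ → k ≢ l →
      ⟦ P ▷[ l ] Q ⟧ ─[ k ⟨ μ ⟩ ∣ (l ∷ []) ↦ k ]→ ⟦ P′ ▷[ k ] Q ⟧

    sync-merge : ∀ {P P′ Q Q′ k a ls₁ ls₂} →
      P ─[ k ⟨ vis a ⟩ ∣ ls₁ ↦ k ]→ P′ →
      Q ─[ k ⟨ vis (co-action a) ⟩ ∣ ls₂ ↦ k ]→ Q′ →
      P ∥ Q ─[ k ⟨ τ ⟩ ∣ (ls₁ ++ ls₂) ↦ k ]→ (P′ [ ls₂ ↦ k ]) ∥ (Q′ [ ls₁ ↦ k ])

    parˡ : ∀ {P P′ Q α σ} →
      P ─[ α ∣ σ ]→ P′ → (∀ k → k ∈range σ → ¬ k ∈ftn Q) →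
      P ∥ Q ─[ α ∣ σ ]→ P′ ∥ (Q [ σ ])

    parʳ : ∀ {P Q Q′ α σ} →
      Q ─[ α ∣ σ ]→ Q′ → (∀ k → k ∈range σ → ¬ k ∈ftn P) →
      P ∥ Q ─[ α ∣ σ ]→ (P [ σ ]) ∥ Q′

    -- The restricted channel does not occur in α exactly when the label
    -- of the body is a weakening.
    restrict : ∀ {P P′ α σ} →
      P ─[ wkLabel α ∣ σ ]→ P′ →
      ν P ─[ α ∣ σ ]→ ν P′

  swap₀₁ : ∀ {n} → Fin (suc (suc n)) → Fin (suc (suc n))
  swap₀₁ zero          = suc zero
  swap₀₁ (suc zero)    = zero
  swap₀₁ (suc (suc i)) = suc (suc i)

  -- Recursion is not unfolded by ≡ₛ: that is a τ-transition.
  data _≡ₛ_ {n m} : Term n m → Term n m → Set where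
    ≡ₛ-refl  : ∀ {P} → P ≡ₛ P
    ≡ₛ-sym   : ∀ {P Q} → P ≡ₛ Q → Q ≡ₛ P
    ≡ₛ-trans : ∀ {P Q R} → P ≡ₛ Q → Q ≡ₛ R → P ≡ₛ R

    ∥-unit   : ∀ {P} → P ∥ 𝟎 ≡ₛ P
    ∥-comm   : ∀ {P Q} → P ∥ Q ≡ₛ Q ∥ P
    ∥-assoc  : ∀ {P Q R} → (P ∥ Q) ∥ R ≡ₛ P ∥ (Q ∥ R)

    ν-𝟎      : ν 𝟎 ≡ₛ 𝟎
    ν-swap   : ∀ {P} → ν (ν P) ≡ₛ ν (ν (renameCh swap₀₁ P))
    ν-extr   : ∀ {P Q} → ν P ∥ Q ≡ₛ ν (P ∥ renameCh suc Q)

    -- Includes reindexing, i.e. commutativity and associativity of sums.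
    sum-cong : ∀ {J J′ μ μ′ P P′} (f : Idx J ↔ Idx J′) →
      (∀ i → μ i ≡ μ′ (Inverse.to f i)) → (∀ i → P i ≡ₛ P′ (Inverse.to f i)) →
      sum J μ P ≡ₛ sum J′ μ′ P′
    ∥-cong   : ∀ {P P′ Q Q′} → P ≡ₛ P′ → Q ≡ₛ Q′ → P ∥ Q ≡ₛ P′ ∥ Q′
    ν-cong   : ∀ {P P′} → P ≡ₛ P′ → ν P ≡ₛ ν P′
    rec-cong : ∀ {P P′} → P ≡ₛ P′ → rec P ≡ₛ rec P′
    ▷-cong   : ∀ {P P′ k Q Q′} → P ≡ₛ P′ → Q ≡ₛ Q′ →
      ⟦ P ▷[ k ] Q ⟧ ≡ₛ ⟦ P′ ▷[ k ] Q′ ⟧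
    ▶-cong   : ∀ {P P′ Q Q′} → P ≡ₛ P′ → Q ≡ₛ Q′ → ⟦ P ▶ Q ⟧ ≡ₛ ⟦ P′ ▶ Q′ ⟧

  data _⇝co_ {n m} : Term n m → Term n m → Set where
    ⇝-co  : co ⇝co 𝟎
    ⇝-sum : ∀ {J μ P} → sum J μ P ⇝co sum J μ P
    ⇝-var : ∀ {X} → var X ⇝co var X
    ⇝-rec : ∀ {P} → rec P ⇝co rec P
    ⇝-▶   : ∀ {P Q} → ⟦ P ▶ Q ⟧ ⇝co ⟦ P ▶ Q ⟧
    ⇝-ν   : ∀ {P P′} → P ⇝co P′ → ν P ⇝co ν P′
    ⇝-∥   : ∀ {P P′ Q Q′} → P ⇝co P′ → Q ⇝co Q′ → P ∥ Q ⇝co P′ ∥ Q′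

  data Reconf : Set where
    commit abort new : TrN → Reconf

  nameOf : Reconf → TrN
  nameOf (commit k) = k
  nameOf (abort k)  = k
  nameOf (new k)    = k

  data Ending : Reconf → Set where
    commits : ∀ {k} → Ending (commit k)
    aborts  : ∀ {k} → Ending (abort k)

  data _─⟪_⟫→_ {n} : Term n 0 → Reconf → Term n 0 → Set where
    do-commit : ∀ {P P′ P″ k Q} → P ≡ₛ co ∥ P″ → P ⇝co P′ →
      ⟦ P ▷[ k ] Q ⟧ ─⟪ commit k ⟫→ P′
    do-new    : ∀ {P Q k} → ⟦ P ▶ Q ⟧ ─⟪ new k ⟫→ ⟦ P ▷[ k ] Q ⟧
    do-abort  : ∀ {P k Q} → ⟦ P ▷[ k ] Q ⟧ ─⟪ abort k ⟫→ Q
    both      : ∀ {P P′ Q Q′ β} → Ending β →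
      P ─⟪ β ⟫→ P′ → Q ─⟪ β ⟫→ Q′ → P ∥ Q ─⟪ β ⟫→ P′ ∥ Q′
    reconfˡ   : ∀ {P P′ Q β} → P ─⟪ β ⟫→ P′ → ¬ nameOf β ∈ftn Q →
      P ∥ Q ─⟪ β ⟫→ P′ ∥ Q
    reconfʳ   : ∀ {P Q Q′ β} → Q ─⟪ β ⟫→ Q′ → ¬ nameOf β ∈ftn P →
      P ∥ Q ─⟪ β ⟫→ P ∥ Q′
    reconf-ν  : ∀ {P P′ β} → P ─⟪ β ⟫→ P′ → ν P ─⟪ β ⟫→ ν P′

  data Status : Set where
    did    : Act → Status
    hasAb  : Status
    hasCo  : Status

  Event : Set
  Event = ExTrN × Status

  History : Set
  History = ℕ → Maybe Event

  _∈trn_ : ExTrN → History → Set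
  k ∈trn H = ∃[ i ] ∃[ s ] H i ≡ just (k , s)

  Hasco : History → Pred ExTrN 0ℓ
  Hasco H k = ∃[ i ] H i ≡ just (k , hasCo)

  _∈ftnᴴ_ : TrN → History → Set
  inj₁ k ∈ftnᴴ H = ⊥
  inj₂ k ∈ftnᴴ H = k ∈trn H

  -- Equivalence relations over a finite subset of TrN are symmetric and
  -- transitive relations with finitely many pairs. Lists are read as
  -- sets: only membership matters, see _≋_.
  FinRel : Set
  FinRel = List (TrN × TrN)

  ⟪_⟫ : FinRel → Rel TrN 0ℓ
  ⟪ E ⟫ k l = (k , l) ∈ E

  _≋_ : FinRel → Rel TrN 0ℓ → Set
  E ≋ R = ∀ k l → ⟪ E ⟫ k l ⇔ R k l

  _∈ftnᴱ_ : TrN → FinRel → Set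
  k ∈ftnᴱ E = ∃[ l ] (⟪ E ⟫ k l ⊎ ⟪ E ⟫ l k)

  record ExtConfig : Set where
    field
      E : FinRel
      H : History
      P : Term 0 0
      process      : IsProcess P
      E-equiv      : IsPartialEquivalence ⟪ E ⟫
      H-finite     : ∃[ is ] (∀ i e → H i ≡ just e → i ∈ is)
      H-injective  : ∀ {i j k s t} → H i ≡ just (k , s) → H j ≡ just (k , t) → i ≡ j
      E-domain     : ∀ (k : ExTrN) → ⟪ E ⟫ (inj₂ k) (inj₂ k) ⇔ (k ∈trn H)
      E-Hasco      : ∀ (k k′ : ExTrN) → ⟪ E ⟫ (inj₂ k) (inj₂ k′) → Hasco H k ⇔ Hasco H k′
      ftn-Hasco    : ∀ (k : ExTrN) → Hasco H k → ¬ inj₂ k ∈ftn P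
      ftn-E        : ∀ k k′ → ⟪ E ⟫ k k′ → k ∈ftn P → k′ ∈ftn P → k ≡ k′
      ftn-external : ∀ (k : ExTrN) → inj₂ k ∈ftn P → k ∈trn H

  open ExtConfig

  -- The symmetric and transitive closure is the smallest equivalence over
  -- a subset of TrN that contains the given pairs.
  merge : NameSubst → FinRel → Rel TrN 0ℓ
  merge σ E = Plus⇔ (λ k l → ⟪ E ⟫ k l ⊎ (l ∈range σ × (k ≡ l ⊎ k ∈ dom σ)))

  open DecMembership (×-≡-dec _≟_ _≟_) using () renaming (_∈?_ to _∈ᴱ?_)

  resolve : FinRel → TrN → Status → Event → Event
  resolve E k s (k′ , did a) =
    if does ((inj₂ k′ , k) ∈ᴱ? E) then (k′ , s) else (k′ , did a)
  resolve E k s (k′ , hasAb) = k′ , hasAb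
  resolve E k s (k′ , hasCo) = k′ , hasCo

  _∖[_]_ : FinRel × History → Status → TrN → History
  ((E , H) ∖[ s ] k) i = Maybe.map (resolve E k s) (H i)

  -- H′ is H extended with e at some new index.
  Extends : History → Event → History → Set
  Extends H e H′ =
    ∃[ i ] (H i ≡ nothing × H′ i ≡ just e × (∀ j → j ≢ i → H′ j ≡ H j))

  data ExtLabel : Set where
    τ    : ExtLabel
    _⟨_⟩ : ExTrN → Act → ExtLabel

  _♯Δ_ : TrN → ExtConfig → Set
  k ♯Δ C = ¬ k ∈ftnᴱ E C × ¬ k ∈ftnᴴ H C

  infix 4 _─[_]→ₑ_ _═[_]⇒_ _≈Eq_

  data _─[_]→ₑ_ (C : ExtConfig) : ExtLabel → ExtConfig → Set where

    e-internal : ∀ {C′} →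
      P C ─[ plain τ ∣ ε ]→ P C′ →
      E C′ ≋ ⟪ E C ⟫ → H C′ ≗ H C →
      C ─[ τ ]→ₑ C′

    e-merge : ∀ {C′ σ} (k : InTrN) →
      P C ─[ inj₁ k ⟨ τ ⟩ ∣ σ ]→ P C′ → inj₁ k ♯Δ C →
      E C′ ≋ merge σ (E C) → H C′ ≗ H C →
      C ─[ τ ]→ₑ C′

    e-new : ∀ {C′} (k : InTrN) →
      P C ─⟪ new (inj₁ k) ⟫→ P C′ → inj₁ k ♯Δ C →
      E C′ ≋ ⟪ E C ⟫ → H C′ ≗ H C →
      C ─[ τ ]→ₑ C′

    e-commit : ∀ {C′} (k : TrN) →
      P C ─⟪ commit k ⟫→ P C′ →
      E C′ ≋ ⟪ E C ⟫ → H C′ ≗ ((E C , H C) ∖[ hasCo ] k) →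
      C ─[ τ ]→ₑ C′

    e-abort : ∀ {C′} (k : TrN) →
      P C ─⟪ abort k ⟫→ P C′ →
      E C′ ≋ ⟪ E C ⟫ → H C′ ≗ ((E C , H C) ∖[ hasAb ] k) →
      C ─[ τ ]→ₑ C′

    e-action : ∀ {C′ σ a} (k : ExTrN) →
      P C ─[ inj₂ k ⟨ vis (free a) ⟩ ∣ σ ]→ P C′ → inj₂ k ♯Δ C →
      E C′ ≋ merge σ (E C) → Extends (H C) (k , did a) (H C′) →
      C ─[ k ⟨ a ⟩ ]→ₑ C′

    e-aborted-action : ∀ {C′ a} (k : ExTrN) →
      inj₂ k ♯Δ C → ¬ inj₂ k ∈ftn P C → P C′ ≡ P C →
      E C′ ≋ (λ l l′ → ⟪ E C ⟫ l l′ ⊎ (l ≡ inj₂ k × l′ ≡ inj₂ k)) →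
      Extends (H C) (k , hasAb) (H C′) →
      C ─[ k ⟨ a ⟩ ]→ₑ C′

  _⇒τ_ : Rel ExtConfig 0ℓ
  _⇒τ_ = Star (λ C C′ → C ─[ τ ]→ₑ C′)

  _═[_]⇒_ : ExtConfig → ExtLabel → ExtConfig → Set
  C ═[ τ ]⇒ C′       = C ⇒τ C′
  C ═[ k ⟨ a ⟩ ]⇒ C′ =
    ∃[ C₁ ] ∃[ C₂ ] (C ⇒τ C₁ × C₁ ─[ k ⟨ a ⟩ ]→ₑ C₂ × C₂ ⇒τ C′)

  _⊨_=co_ : ExtConfig → ExTrN → ExTrN → Set
  C ⊨ k =co k′ = Hasco (H C) k × Hasco (H C) k′ × ⟪ E C ⟫ (inj₂ k) (inj₂ k′)

  Eq : Rel ExtConfig 0ℓ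
  Eq C₁ C₂ = ∀ k k′ → (C₁ ⊨ k =co k′) ⇔ (C₂ ⊨ k =co k′)

  _♯_ : ExtLabel → ExtConfig → Set
  τ         ♯ C = ⊤
  (k ⟨ a ⟩) ♯ C = inj₂ k ♯Δ C × ¬ inj₂ k ∈ftn P C

  record IsEqBisimulation (R : Rel ExtConfig 0ℓ) : Set where
    field
      eq    : ∀ {C₁ C₂} → R C₁ C₂ → Eq C₁ C₂
      forth : ∀ {C₁ C₂ C₁′ ζ} → R C₁ C₂ → C₁ ═[ ζ ]⇒ C₁′ → ζ ♯ C₂ →
              ∃[ C₂′ ] (C₂ ═[ ζ ]⇒ C₂′ × R C₁′ C₂′)
      back  : ∀ {C₁ C₂ C₂′ ζ} → R C₁ C₂ → C₂ ═[ ζ ]⇒ C₂′ → ζ ♯ C₁ →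
              ∃[ C₁′ ] (C₁ ═[ ζ ]⇒ C₁′ × R C₁′ C₂′)

  _≈Eq_ : ExtConfig → ExtConfig → Set₁
  C₁ ≈Eq C₂ = ∃[ R ] (IsEqBisimulation R × R C₁ C₂)

  -- `Formula n` has its free variables among n de Bruijn indices, bound
  -- by enclosing ⟨ x(a) ⟩'s; closed formulae are `Formula 0`.
  Value : ℕ → Set
  Value n = ExTrN ⊎ Fin n

  data Formula (n : ℕ) : Set₁ where
    ⟨τ⟩_    : Formula n → Formula n
    ⟨x_⟩_   : Act → Formula (suc n) → Formula n
    ¬̇_      : Formula n → Formula n
    ⋀       : (K : Set) → (K → Formula n) → Formula n
    _=̇co_   : Value n → Value n → Formula n

  Env : ℕ → Set
  Env n = Vector.Vector ExTrN n

  value : ∀ {n} → Env n → Value n → ExTrN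
  value ρ (inj₁ k) = k
  value ρ (inj₂ x) = ρ x

  -- Substitution of names for variables is delayed in an environment so
  -- that satisfaction is structurally recursive; ⊨-diamond below is the
  -- defining clause in terms of φ[l/x]. A cofinite set is given by the
  -- finite list of names it excludes.
  _⊨[_]_ : ∀ {n} → ExtConfig → Env n → Formula n → Set
  C ⊨[ ρ ] (⟨τ⟩ φ)   = ∃[ C′ ] (C ═[ τ ]⇒ C′ × C′ ⊨[ ρ ] φ)
  C ⊨[ ρ ] (⟨x a ⟩ φ) = Σ[ excluded ∈ List ExTrN ] (∀ l → l ∉ excluded →
                          ∃[ C′ ] (C ═[ l ⟨ a ⟩ ]⇒ C′ × C′ ⊨[ l Vector.∷ ρ ] φ))
  C ⊨[ ρ ] (¬̇ φ)     = ¬ (C ⊨[ ρ ] φ)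
  C ⊨[ ρ ] (⋀ K φ)   = ∀ i → C ⊨[ ρ ] φ i
  C ⊨[ ρ ] (v =̇co w) = C ⊨ value ρ v =co value ρ w

  infix 4 _⊨_

  _⊨_ : ExtConfig → Formula 0 → Set
  C ⊨ φ = C ⊨[ Vector.[] ] φ

  liftV : ∀ {n m} → (Fin n → Value m) → Fin (suc n) → Value (suc m)
  liftV θ zero = inj₂ zero
  liftV θ (suc x) with θ x
  ... | inj₁ k = inj₁ k
  ... | inj₂ y = inj₂ (suc y)

  substV : ∀ {n m} → (Fin n → Value m) → Value n → Value m
  substV θ (inj₁ k) = inj₁ k
  substV θ (inj₂ x) = θ x

  substF : ∀ {n m} → (Fin n → Value m) → Formula n → Formula m
  substF θ (⟨τ⟩ φ)    = ⟨τ⟩ substF θ φ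
  substF θ (⟨x a ⟩ φ) = ⟨x a ⟩ substF (liftV θ) φ
  substF θ (¬̇ φ)      = ¬̇ substF θ φ
  substF θ (⋀ K φ)    = ⋀ K (λ i → substF θ (φ i))
  substF θ (v =̇co w)  = substV θ v =̇co substV θ w

  _[_/x] : Formula 1 → ExTrN → Formula 0
  φ [ l /x] = substF (λ _ → inj₁ l) φ

  ⊨-subst : ∀ {n m} {C} (φ : Formula n) (θ : Fin n → Value m) (ρ : Env m) (ρ′ : Env n) →
            (∀ x → value ρ (θ x) ≡ ρ′ x) →
            (C ⊨[ ρ ] substF θ φ) ⇔ (C ⊨[ ρ′ ] φ)
  ⊨-subst (⟨τ⟩ φ) θ ρ ρ′ eq = mk⇔
    (λ (C′ , t , s) → C′ , t , Equivalence.to (⊨-subst φ θ ρ ρ′ eq) s)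
    (λ (C′ , t , s) → C′ , t , Equivalence.from (⊨-subst φ θ ρ ρ′ eq) s)
  ⊨-subst (⟨x a ⟩ φ) θ ρ ρ′ eq = mk⇔
    (λ (N , f) → N , λ l l∉ → let (C′ , t , s) = f l l∉ in
      C′ , t , Equivalence.to (⊨-subst φ (liftV θ) (l Vector.∷ ρ) (l Vector.∷ ρ′) (eq′ l)) s)
    (λ (N , f) → N , λ l l∉ → let (C′ , t , s) = f l l∉ in
      C′ , t , Equivalence.from (⊨-subst φ (liftV θ) (l Vector.∷ ρ) (l Vector.∷ ρ′) (eq′ l)) s)
    where
    eq′ : ∀ l x → value (l Vector.∷ ρ) (liftV θ x) ≡ (l Vector.∷ ρ′) x
    eq′ l zero = refl
    eq′ l (suc x) with θ x | eq x
    ... | inj₁ k | e = e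
    ... | inj₂ y | e = e
  ⊨-subst (¬̇ φ) θ ρ ρ′ eq = mk⇔
    (λ ns s → ns (Equivalence.from (⊨-subst φ θ ρ ρ′ eq) s))
    (λ ns s → ns (Equivalence.to (⊨-subst φ θ ρ ρ′ eq) s))
  ⊨-subst (⋀ K φ) θ ρ ρ′ eq = mk⇔
    (λ s i → Equivalence.to (⊨-subst (φ i) θ ρ ρ′ eq) (s i))
    (λ s i → Equivalence.from (⊨-subst (φ i) θ ρ ρ′ eq) (s i))
  ⊨-subst {C = C} (v =̇co w) θ ρ ρ′ eq = mk⇔
    (subst₂ (C ⊨_=co_) (eqV v) (eqV w))
    (subst₂ (C ⊨_=co_) (sym (eqV v)) (sym (eqV w)))
    where
    eqV : ∀ u → value ρ (substV θ u) ≡ value ρ′ u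
    eqV (inj₁ k) = refl
    eqV (inj₂ x) = eq x

  ⊨-diamond : ∀ {C a} (φ : Formula 1) →
    (C ⊨ (⟨x a ⟩ φ)) ⇔
    (Σ[ excluded ∈ List ExTrN ] (∀ l → l ∉ excluded →
       ∃[ C′ ] (C ═[ l ⟨ a ⟩ ]⇒ C′ × C′ ⊨ φ [ l /x])))
  ⊨-diamond φ = mk⇔
    (λ (N , f) → N , λ l l∉ → let (C′ , t , s) = f l l∉ in
      C′ , t , Equivalence.from (inst l) s)
    (λ (N , f) → N , λ l l∉ → let (C′ , t , s) = f l l∉ in
      C′ , t , Equivalence.to (inst l) s)
    where
    inst : ∀ l {C′} → (C′ ⊨ φ [ l /x]) ⇔ (C′ ⊨[ l Vector.∷ Vector.[] ] φ)
    inst l = ⊨-subst φ (λ _ → inj₁ l) Vector.[] (l Vector.∷ Vector.[]) λ { zero → refl }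

  record Process : Set where
    field
      term         : Term 0 0
      isProcess    : IsProcess term
      -- By convention, the external names of a configuration are those
      -- in its history, here the empty one.
      ftn-internal : ∀ (k : ExTrN) → ¬ inj₂ k ∈ftn term

  initial : Process → ExtConfig
  initial Q = record
    { E            = []
    ; H            = λ _ → nothing
    ; P            = Process.term Q
    ; process      = Process.isProcess Q
    ; E-equiv      = record { sym = λ () ; trans = λ () }
    ; H-finite     = [] , λ _ _ ()
    ; H-injective  = λ ()
    ; E-domain     = λ k → mk⇔ (λ ()) (λ ())
    ; E-Hasco      = λ _ _ ()
    ; ftn-Hasco    = λ _ ()
    ; ftn-E        = λ _ _ ()
    ; ftn-external = λ k k∈ → ⊥-elim (Process.ftn-internal Q k k∈)
    }

  _≈Eqₚ_ : Process → Process → Set₁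
  Q₁ ≈Eqₚ Q₂ = initial Q₁ ≈Eq initial Q₂

  𝓛Eq : Process → Pred (Formula 0) 0ℓ
  𝓛Eq Q φ = initial Q ⊨ φ

-- Bisimilar configurations satisfy the same formulae by induction on the
-- formula: a cofinite set of names stays cofinite when the finitely many
-- names of the matching configuration are removed.
--
-- Conversely, call C and D indistinguishable if their histories have the same
-- names, listed by an environment ρ, and they agree under ρ on all formulae
-- without constants. This is an Eq-bisimulation: if C ⇒ C′ were matched by no
-- D ⇒ D′, the conjunction Φ of the formulae separating C′ from each D′ would,
-- under a diamond, separate C from D. When the label is k(a), the diamond
-- quantifies over cofinitely many l while C ⇒ C′ uses the one name k; since k
-- and l are both fresh, the transposition (k l) fixes C, D and ρ and preserves
-- transitions and satisfaction. Letting environments supply every name keeps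
-- Φ, an infinite conjunction, from mentioning infinitely many of them.
module Submission where

open import Defs
open import Axiom.ExcludedMiddle using (ExcludedMiddle)
open import Data.Empty using (⊥; ⊥-elim)
open import Data.List using (List; []; _∷_; _++_; map; mapMaybe)
open import Data.List.Membership.Propositional using (_∈_; _∉_; lose)
open import Data.List.Membership.Propositional.Properties
  using (∈-map⁺; ∈-map⁻; ∈-++⁺ˡ; ∈-++⁺ʳ; finite)
import Data.List.Membership.DecPropositional as DecMembership
open import Data.List.Properties using (map-++)
open import Data.List.Relation.Unary.Any.Properties using (mapMaybe⁺)
open import Data.Maybe using (just; nothing)
import Data.Maybe as Maybe
import Data.Maybe.Relation.Unary.Any as MAny
open import Data.Nat using (ℕ) renaming (_≟_ to _≟ℕ_)
open import Data.Product using (_×_; _,_; Σ-syntax; ∃-syntax; proj₁; proj₂)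
import Data.Product as Product
open import Data.Product.Properties using () renaming (≡-dec to ×-≡-dec)
open import Data.Sum using (_⊎_; inj₁; inj₂)
import Data.Sum as Sum
open import Data.Unit using (⊤; tt)
import Data.Vec.Functional as Vector
open import Function using (_∘_; _⇔_; mk⇔; Equivalence; Injection; flip; case_of_)
open import Function.Construct.Composition using (_⇔-∘_)
open import Function.Construct.Symmetry using (⇔-sym)
import Level
open import Level using (0ℓ; Lift; lift; lower)
open import Relation.Binary.Core using (Rel)
open import Relation.Binary.Structures using (IsPartialEquivalence)
open import Relation.Binary.PropositionalEquality
  using (_≡_; _≢_; _≗_; refl; sym; trans; cong; cong₂; subst; subst₂)
open import Relation.Binary.Construct.Closure.ReflexiveTransitive using (_◅_) renaming (ε to done)
open import Relation.Binary.Construct.Closure.SymmetricTransitive using (forth; back; forth⁺; back⁺)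
open import Relation.Nullary using (¬_; Dec; yes; no; contradiction)
open import Relation.Nullary.Decidable using (does-⇔; True; toWitness; fromWitness; map′)
open import Relation.Unary using (_≐_)

open Equivalence using (to; from)

module _ {S : Signature} where
  open import Data.Fin using (Fin; zero; suc)
  open Signature S
  open TCCS S hiding (lift)
  open ExtConfig
  open DecMembership _≟_ using (_∈?_)
  open DecMembership (×-≡-dec _≟_ _≟_) using () renaming (_∈?_ to _∈ᴱ?_)

  -- Operations that preserve the absence of transaction names

  NoTrN-renameCh : ∀ {n n′ m} (ρ : Fin n → Fin n′) (P : Term n m) → NoTrN P → NoTrN (renameCh ρ P)
  NoTrN-renameCh ρ (sum J μ P)    ∉P k (in-sum i p) = NoTrN-renameCh ρ (P i) (λ l → ∉P l ∘ in-sum i) k p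
  NoTrN-renameCh ρ (P ∥ Q)        ∉P k (in-∥ˡ p)    = NoTrN-renameCh ρ P (λ l → ∉P l ∘ in-∥ˡ) k p
  NoTrN-renameCh ρ (P ∥ Q)        ∉P k (in-∥ʳ p)    = NoTrN-renameCh ρ Q (λ l → ∉P l ∘ in-∥ʳ) k p
  NoTrN-renameCh ρ (ν P)          ∉P k (in-ν p)     = NoTrN-renameCh _ P (λ l → ∉P l ∘ in-ν) k p
  NoTrN-renameCh ρ (rec P)        ∉P k (in-rec p)   = NoTrN-renameCh ρ P (λ l → ∉P l ∘ in-rec) k p
  NoTrN-renameCh ρ ⟦ P ▷[ h ] Q ⟧ ∉P k _            = ∉P h here-▷
  NoTrN-renameCh ρ ⟦ P ▶ Q ⟧      ∉P k (in-▶ˡ p)    = NoTrN-renameCh ρ P (λ l → ∉P l ∘ in-▶ˡ) k p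
  NoTrN-renameCh ρ ⟦ P ▶ Q ⟧      ∉P k (in-▶ʳ p)    = NoTrN-renameCh ρ Q (λ l → ∉P l ∘ in-▶ʳ) k p

  NoTrN-renameVar : ∀ {n m m′} (ρ : Fin m → Fin m′) (P : Term n m) → NoTrN P → NoTrN (renameVar ρ P)
  NoTrN-renameVar ρ (sum J μ P)    ∉P k (in-sum i p) = NoTrN-renameVar ρ (P i) (λ l → ∉P l ∘ in-sum i) k p
  NoTrN-renameVar ρ (P ∥ Q)        ∉P k (in-∥ˡ p)    = NoTrN-renameVar ρ P (λ l → ∉P l ∘ in-∥ˡ) k p
  NoTrN-renameVar ρ (P ∥ Q)        ∉P k (in-∥ʳ p)    = NoTrN-renameVar ρ Q (λ l → ∉P l ∘ in-∥ʳ) k p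
  NoTrN-renameVar ρ (ν P)          ∉P k (in-ν p)     = NoTrN-renameVar ρ P (λ l → ∉P l ∘ in-ν) k p
  NoTrN-renameVar ρ (rec P)        ∉P k (in-rec p)   = NoTrN-renameVar _ P (λ l → ∉P l ∘ in-rec) k p
  NoTrN-renameVar ρ ⟦ P ▷[ h ] Q ⟧ ∉P k _            = ∉P h here-▷
  NoTrN-renameVar ρ ⟦ P ▶ Q ⟧      ∉P k (in-▶ˡ p)    = ∉P k (in-▶ˡ p)
  NoTrN-renameVar ρ ⟦ P ▶ Q ⟧      ∉P k (in-▶ʳ p)    = NoTrN-renameVar ρ Q (λ l → ∉P l ∘ in-▶ʳ) k p

  NoTrN-substVar : ∀ {n m m′} (θ : Fin m → Term n m′) (P : Term n m) →
    (∀ X → NoTrN (θ X)) → NoTrN P → NoTrN (substVar θ P)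
  NoTrN-substVar θ (sum J μ P)    ∉θ ∉P k (in-sum i p) = NoTrN-substVar θ (P i) ∉θ (λ l → ∉P l ∘ in-sum i) k p
  NoTrN-substVar θ (P ∥ Q)        ∉θ ∉P k (in-∥ˡ p)    = NoTrN-substVar θ P ∉θ (λ l → ∉P l ∘ in-∥ˡ) k p
  NoTrN-substVar θ (P ∥ Q)        ∉θ ∉P k (in-∥ʳ p)    = NoTrN-substVar θ Q ∉θ (λ l → ∉P l ∘ in-∥ʳ) k p
  NoTrN-substVar θ (ν P)          ∉θ ∉P k (in-ν p)     =
    NoTrN-substVar _ P (λ X → NoTrN-renameCh suc (θ X) (∉θ X)) (λ l → ∉P l ∘ in-ν) k p
  NoTrN-substVar θ (var X)        ∉θ ∉P k p            = ∉θ X k p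
  NoTrN-substVar θ (rec P)        ∉θ ∉P k (in-rec p)   = NoTrN-substVar _ P ∉liftS (λ l → ∉P l ∘ in-rec) k p
    where
    ∉liftS : ∀ X → NoTrN (liftS θ X)
    ∉liftS zero    l ()
    ∉liftS (suc X) = NoTrN-renameVar suc (θ X) (∉θ X)
  NoTrN-substVar θ ⟦ P ▷[ h ] Q ⟧ ∉θ ∉P k _            = ∉P h here-▷
  NoTrN-substVar θ ⟦ P ▶ Q ⟧      ∉θ ∉P k (in-▶ˡ p)    = ∉P k (in-▶ˡ p)
  NoTrN-substVar θ ⟦ P ▶ Q ⟧      ∉θ ∉P k (in-▶ʳ p)    = NoTrN-substVar θ Q ∉θ (λ l → ∉P l ∘ in-▶ʳ) k p

  -- Renaming will leave `rec P` as it is, so the unfolding, which appears at top level after the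
  -- step, has to be fixed by renaming too; being name-free ensures this.
  NoTrN-unfold : ∀ {n} (P : Term n 1) → NoTrN P → NoTrN (unfold P)
  NoTrN-unfold P ∉P = NoTrN-substVar _ P (λ { X k (in-rec p) → ∉P k p }) ∉P

  -- The same concern for commits: the body of a transaction surfaces at top level, where renaming
  -- could otherwise act on it.
  NoTrN-⇝co : ∀ {n m} {P P′ : Term n m} → P ⇝co P′ → NoTrN P → NoTrN P′
  NoTrN-⇝co ⇝-co      ∉P k (in-sum () _)
  NoTrN-⇝co ⇝-sum     ∉P = ∉P
  NoTrN-⇝co ⇝-var     ∉P = ∉P
  NoTrN-⇝co ⇝-rec     ∉P = ∉P
  NoTrN-⇝co ⇝-▶       ∉P = ∉P
  NoTrN-⇝co (⇝-ν c)   ∉P k (in-ν p)  = NoTrN-⇝co c (λ l → ∉P l ∘ in-ν) k p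
  NoTrN-⇝co (⇝-∥ c d) ∉P k (in-∥ˡ p) = NoTrN-⇝co c (λ l → ∉P l ∘ in-∥ˡ) k p
  NoTrN-⇝co (⇝-∥ c d) ∉P k (in-∥ʳ p) = NoTrN-⇝co d (λ l → ∉P l ∘ in-∥ʳ) k p

  -- Formulae without name constants

  NameFreeᵛ : ∀ {n} → Value n → Set
  NameFreeᵛ (inj₁ k) = ⊥
  NameFreeᵛ (inj₂ x) = ⊤

  -- With constants excluded, a renaming acts on satisfaction through the environment alone and the
  -- formula itself stays the same.
  NameFree : ∀ {n} → Formula n → Set
  NameFree (⟨τ⟩ φ)    = NameFree φ
  NameFree (⟨x a ⟩ φ) = NameFree φ
  NameFree (¬̇ φ)      = NameFree φ
  NameFree (⋀ K φ)    = ∀ i → NameFree (φ i)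
  NameFree (v =̇co w)  = NameFreeᵛ v × NameFreeᵛ w

  -- Renaming external names in terms by an involution

  module Renaming (π : ExTrN → ExTrN) (π-involutive : ∀ k → π (π k) ≡ k) where

    -- Internal names are fixed, since labels of extended transitions and environments hold external
    -- names only. As the map is its own inverse, each one-way transport below also yields its
    -- converse.
    πN : TrN → TrN
    πN = Sum.map₂ π

    πN-involutive : ∀ k → πN (πN k) ≡ k
    πN-involutive (inj₁ k) = refl
    πN-involutive (inj₂ k) = cong inj₂ (π-involutive k)

    πN-injective : ∀ {k l} → πN k ≡ πN l → k ≡ l
    πN-injective {k} {l} e = trans (sym (πN-involutive k)) (trans (cong πN e) (πN-involutive l))

    -- Stops where well-formedness excludes names: renaming inside the functions
    -- of a sum would make ren-involutive depend on function extensionality.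
    ren : ∀ {n m} → Term n m → Term n m
    ren (sum J μ P)    = sum J μ P
    ren (P ∥ Q)        = ren P ∥ ren Q
    ren (ν P)          = ν (ren P)
    ren (var X)        = var X
    ren (rec P)        = rec P
    ren ⟦ P ▷[ k ] Q ⟧ = ⟦ P ▷[ πN k ] Q ⟧
    ren co             = co
    ren ⟦ P ▶ Q ⟧      = ⟦ P ▶ Q ⟧

    renS : NameSubst → NameSubst
    renS ε        = ε
    renS (ks ↦ l) = map πN ks ↦ πN l

    renL : ∀ {n} → Label n → Label n
    renL (plain μ) = plain μ
    renL (k ⟨ μ ⟩) = πN k ⟨ μ ⟩

    renR : Reconf → Reconf
    renR (commit k) = commit (πN k)
    renR (abort k)  = abort (πN k)
    renR (new k)    = new (πN k)

    renE : ExtLabel → ExtLabel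
    renE τ         = τ
    renE (k ⟨ a ⟩) = π k ⟨ a ⟩

    renEvent : Event → Event
    renEvent = Product.map₁ π

    ren-involutive : ∀ {n m} (P : Term n m) → ren (ren P) ≡ P
    ren-involutive (sum J μ P)    = refl
    ren-involutive (P ∥ Q)        = cong₂ _∥_ (ren-involutive P) (ren-involutive Q)
    ren-involutive (ν P)          = cong ν (ren-involutive P)
    ren-involutive (var X)        = refl
    ren-involutive (rec P)        = refl
    ren-involutive ⟦ P ▷[ k ] Q ⟧ = cong ⟦ P ▷[_] Q ⟧ (πN-involutive k)
    ren-involutive co             = refl
    ren-involutive ⟦ P ▶ Q ⟧      = refl

    ren-fixed : ∀ {n m} (P : Term n m) → (∀ k → k ∈ftn P → πN k ≡ k) → ren P ≡ P
    ren-fixed (sum J μ P)    fix = refl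
    ren-fixed (P ∥ Q)        fix =
      cong₂ _∥_ (ren-fixed P (λ k → fix k ∘ in-∥ˡ)) (ren-fixed Q (λ k → fix k ∘ in-∥ʳ))
    ren-fixed (ν P)          fix = cong ν (ren-fixed P (λ k → fix k ∘ in-ν))
    ren-fixed (var X)        fix = refl
    ren-fixed (rec P)        fix = refl
    ren-fixed ⟦ P ▷[ k ] Q ⟧ fix = cong ⟦ P ▷[_] Q ⟧ (fix k here-▷)
    ren-fixed co             fix = refl
    ren-fixed ⟦ P ▶ Q ⟧      fix = refl

    ren-NoTrN : ∀ {n m} (P : Term n m) → NoTrN P → ren P ≡ P
    ren-NoTrN P ∉P = ren-fixed P (λ k → ⊥-elim ∘ ∉P k)

    renS-involutive : ∀ σ → renS (renS σ) ≡ σ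
    renS-involutive ε        = refl
    renS-involutive (ks ↦ l) = cong₂ _↦_ (maps ks) (πN-involutive l)
      where
      maps : ∀ ks → map πN (map πN ks) ≡ ks
      maps []       = refl
      maps (k ∷ ks) = cong₂ _∷_ (πN-involutive k) (maps ks)

    ∈-map-πN : ∀ {k ks} → (πN k ∈ map πN ks) ⇔ (k ∈ ks)
    ∈-map-πN {k} {ks} = mk⇔ unmap (∈-map⁺ πN)
      where
      unmap : πN k ∈ map πN ks → k ∈ ks
      unmap πk∈ with l , l∈ , e ← ∈-map⁻ πN πk∈ rewrite πN-injective {k} {l} e = l∈

    applyN-ren : ∀ σ k → πN (applyN σ k) ≡ applyN (renS σ) (πN k)
    applyN-ren ε        k = refl
    applyN-ren (ks ↦ l) k
      -- `applyN` depends only on the outcome of the membership test, and injectivity of `πN` makes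
      -- the two outcomes agree.
      rewrite does-⇔ ∈-map-πN (πN k ∈? map πN ks) (k ∈? ks) with k ∈? ks
    ... | yes _ = refl
    ... | no  _ = refl

    ren-subst : ∀ {n m} (P : Term n m) σ → ren (P [ σ ]) ≡ ren P [ renS σ ]
    ren-subst (sum J μ P)    σ = refl
    ren-subst (P ∥ Q)        σ = cong₂ _∥_ (ren-subst P σ) (ren-subst Q σ)
    ren-subst (ν P)          σ = cong ν (ren-subst P σ)
    ren-subst (var X)        σ = refl
    ren-subst (rec P)        σ = refl
    ren-subst ⟦ P ▷[ k ] Q ⟧ σ = cong ⟦ P ▷[_] Q ⟧ (applyN-ren σ k)
    ren-subst co             σ = refl
    ren-subst ⟦ P ▶ Q ⟧      σ = refl

    WellFormed-ren : ∀ {n m} (P : Term n m) → WellFormed P → WellFormed (ren P)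
    WellFormed-ren (sum J μ P)    wf        = wf
    WellFormed-ren (P ∥ Q)        (wf , wf′) = WellFormed-ren P wf , WellFormed-ren Q wf′
    WellFormed-ren (ν P)          wf        = WellFormed-ren P wf
    WellFormed-ren (var X)        wf        = wf
    WellFormed-ren (rec P)        wf        = wf
    WellFormed-ren ⟦ P ▷[ k ] Q ⟧ wf        = wf
    WellFormed-ren co             wf        = wf
    WellFormed-ren ⟦ P ▶ Q ⟧      wf        = wf

    -- Well-formedness is what makes this true: a name inside a sum, a recursion or a component of a
    -- transaction would survive `ren` unchanged.
    ∈ftn-ren⁻ : ∀ {n m} (P : Term n m) → WellFormed P → ∀ {k} → k ∈ftn ren P → πN k ∈ftn P
    ∈ftn-ren⁻ (sum J μ P)    wf (in-sum i p)        = contradiction p (proj₁ (wf i) _)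
    ∈ftn-ren⁻ (P ∥ Q)        (wf , _) (in-∥ˡ p)     = in-∥ˡ (∈ftn-ren⁻ P wf p)
    ∈ftn-ren⁻ (P ∥ Q)        (_ , wf) (in-∥ʳ p)     = in-∥ʳ (∈ftn-ren⁻ Q wf p)
    ∈ftn-ren⁻ (ν P)          wf (in-ν p)            = in-ν (∈ftn-ren⁻ P wf p)
    ∈ftn-ren⁻ (rec P)        (∉P , _) (in-rec p)    = contradiction p (∉P _)
    ∈ftn-ren⁻ ⟦ P ▷[ k ] Q ⟧ wf here-▷              =
      subst (_∈ftn ⟦ P ▷[ k ] Q ⟧) (sym (πN-involutive k)) here-▷
    ∈ftn-ren⁻ ⟦ P ▷[ k ] Q ⟧ (∉P , _) (in-▷ˡ p)     = contradiction p (∉P _)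
    ∈ftn-ren⁻ ⟦ P ▷[ k ] Q ⟧ (_ , ∉Q , _) (in-▷ʳ p) = contradiction p (∉Q _)
    ∈ftn-ren⁻ ⟦ P ▶ Q ⟧      (∉P , _) (in-▶ˡ p)     = contradiction p (∉P _)
    ∈ftn-ren⁻ ⟦ P ▶ Q ⟧      (_ , ∉Q , _) (in-▶ʳ p) = contradiction p (∉Q _)

    ∉ftn-ren : ∀ {n m} (P : Term n m) → WellFormed P → ∀ {k} → ¬ k ∈ftn P → ¬ πN k ∈ftn ren P
    ∉ftn-ren P wf {k} k∉ p = k∉ (subst (_∈ftn P) (πN-involutive k) (∈ftn-ren⁻ P wf p))

    ∉ftn-ren-range : ∀ {n m} (P : Term n m) → WellFormed P → ∀ σ →
      (∀ k → k ∈range σ → ¬ k ∈ftn P) → ∀ k → k ∈range renS σ → ¬ k ∈ftn ren P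
    ∉ftn-ren-range P wf (ks ↦ l) ♯P _ is-range = ∉ftn-ren P wf (♯P l is-range)

    -- Equivariance of process and reconfiguration transitions

    renL-wk : ∀ {n} (α : Label n) → renL (wkLabel α) ≡ wkLabel (renL α)
    renL-wk (plain μ) = refl
    renL-wk (k ⟨ μ ⟩) = refl

    -- Steps of sums and recursions expose terms that are name-free by well-formedness, hence fixed
    -- by `ren`. The freshness side conditions carry over because `πN` is injective.
    step-ren : ∀ {n} {P P′ : Term n 0} {α σ} → WellFormed P →
      P ─[ α ∣ σ ]→ P′ → ren P ─[ renL α ∣ renS σ ]→ ren P′
    step-ren wf (sum-step {P = P} j) rewrite ren-NoTrN (P j) (proj₁ (wf j)) = sum-step j
    step-ren (wf , wf′) (sync s t) = sync (step-ren wf s) (step-ren wf′ t)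
    step-ren (∉P , _) (rec-step {P}) rewrite ren-NoTrN (unfold P) (NoTrN-unfold P ∉P) = rec-step
    step-ren wf (sum-join k j e) = sum-join (πN k) j e
    step-ren wf (run-step s k≢l) = run-step s (k≢l ∘ πN-injective)
    step-ren (wf , wf′) (sync-merge {P′ = P′} {Q′ = Q′} {k} {ls₁ = ls₁} {ls₂} s t)
      rewrite map-++ πN ls₁ ls₂ | ren-subst P′ (ls₂ ↦ k) | ren-subst Q′ (ls₁ ↦ k)
      = sync-merge (step-ren wf s) (step-ren wf′ t)
    step-ren (wf , wf′) (parˡ {Q = Q} {σ = σ} s ♯Q) rewrite ren-subst Q σ
      = parˡ (step-ren wf s) (∉ftn-ren-range Q wf′ σ ♯Q)
    step-ren (wf , wf′) (parʳ {P = P} {σ = σ} s ♯P) rewrite ren-subst P σ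
      = parʳ (step-ren wf′ s) (∉ftn-ren-range P wf σ ♯P)
    step-ren {σ = σ} wf (restrict {P} {P′} {α} s) =
      restrict (subst (λ β → ren P ─[ β ∣ renS σ ]→ ren P′) (renL-wk α) (step-ren wf s))

    nameOf-renR : ∀ β → nameOf (renR β) ≡ πN (nameOf β)
    nameOf-renR (commit k) = refl
    nameOf-renR (abort k)  = refl
    nameOf-renR (new k)    = refl

    reconf-ren : ∀ {n} {P P′ : Term n 0} {β} → WellFormed P →
      P ─⟪ β ⟫→ P′ → ren P ─⟪ renR β ⟫→ ren P′
    reconf-ren (∉P , _) (do-commit {P′ = P′} e c) rewrite ren-NoTrN P′ (NoTrN-⇝co c ∉P) = do-commit e c
    reconf-ren wf do-new = do-new
    reconf-ren (_ , ∉Q , _) (do-abort {Q = Q}) rewrite ren-NoTrN Q ∉Q = do-abort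
    reconf-ren (wf , wf′) (both commits r s) = both commits (reconf-ren wf r) (reconf-ren wf′ s)
    reconf-ren (wf , wf′) (both aborts r s)  = both aborts (reconf-ren wf r) (reconf-ren wf′ s)
    reconf-ren (wf , wf′) (reconfˡ {Q = Q} {β} r ♯Q) =
      reconfˡ (reconf-ren wf r) (subst (λ k → ¬ k ∈ftn ren Q) (sym (nameOf-renR β)) (∉ftn-ren Q wf′ ♯Q))
    reconf-ren (wf , wf′) (reconfʳ {P = P} {β = β} r ♯P) =
      reconfʳ (reconf-ren wf′ r) (subst (λ k → ¬ k ∈ftn ren P) (sym (nameOf-renR β)) (∉ftn-ren P wf ♯P))
    reconf-ren wf (reconf-ν r) = reconf-ν (reconf-ren wf r)

    -- Renaming of histories and configurations

    map-renEvent⁺ : ∀ {m k s} → m ≡ just (k , s) → Maybe.map renEvent m ≡ just (π k , s)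
    map-renEvent⁺ = cong (Maybe.map renEvent)

    map-renEvent-involutive : ∀ m → Maybe.map renEvent (Maybe.map renEvent m) ≡ m
    map-renEvent-involutive nothing        = refl
    map-renEvent-involutive (just (k , s)) = cong (λ l → just (l , s)) (π-involutive k)

    map-renEvent⁻ : ∀ {m k s} → Maybe.map renEvent m ≡ just (k , s) → m ≡ just (π k , s)
    map-renEvent⁻ {m} e = trans (sym (map-renEvent-involutive m)) (map-renEvent⁺ e)

    -- A relation in place of an equation between `D` and a renamed `C`: configurations contain
    -- proofs, histories are compared pointwise, and the lists `E` count only up to membership. In
    -- particular `C ~ C` expresses that the renaming fixes `C`.
    record _~_ (C D : ExtConfig) : Set where
      field
        P-ren : P D ≡ ren (P C)
        E-ren : ∀ {k l} → ⟪ E C ⟫ k l → ⟪ E D ⟫ (πN k) (πN l)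
        E-ren⁻ : ∀ {k l} → ⟪ E D ⟫ k l → ⟪ E C ⟫ (πN k) (πN l)
        H-ren : ∀ i → H D i ≡ Maybe.map renEvent (H C i)

      H-ren⁺ : ∀ {i k s} → H C i ≡ just (k , s) → H D i ≡ just (π k , s)
      H-ren⁺ {i} e = trans (H-ren i) (map-renEvent⁺ e)

    open _~_

    ~-sym : ∀ {C D} → C ~ D → D ~ C
    ~-sym {C} {D} r = record
      { P-ren  = trans (sym (ren-involutive (P C))) (cong ren (sym (P-ren r)))
      ; E-ren  = E-ren⁻ r
      ; E-ren⁻ = E-ren r
      ; H-ren  = λ i → trans (sym (map-renEvent-involutive (H C i)))
                             (cong (Maybe.map renEvent) (sym (H-ren r i)))
      }

    Hasco-~ : ∀ {C D} → C ~ D → ∀ {k} → Hasco (H C) k → Hasco (H D) (π k)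
    Hasco-~ r (i , e) = i , H-ren⁺ r e

    ∈trn-~ : ∀ {C D} → C ~ D → ∀ {k} → k ∈trn H C → π k ∈trn H D
    ∈trn-~ r (i , s , e) = i , s , H-ren⁺ r e

    =co-~ : ∀ {C D} → C ~ D → ∀ {k l} → C ⊨ k =co l → D ⊨ π k =co π l
    =co-~ r (kco , lco , kEl) = Hasco-~ r kco , Hasco-~ r lco , E-ren r kEl

    ♯Δ-~ : ∀ {C D} → C ~ D → ∀ k → k ♯Δ C → πN k ♯Δ D
    ♯Δ-~ {C} {D} r k (♯E , ♯H) =
        (λ { (l , inj₁ kEl) → ♯E (πN l , inj₁ (subst (λ h → ⟪ E C ⟫ h (πN l)) (πN-involutive k) (E-ren⁻ r kEl)))
           ; (l , inj₂ lEk) → ♯E (πN l , inj₂ (subst (⟪ E C ⟫ (πN l)) (πN-involutive k) (E-ren⁻ r lEk))) })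
      , ♯H′ k ♯H
      where
      ♯H′ : ∀ k → ¬ k ∈ftnᴴ H C → ¬ πN k ∈ftnᴴ H D
      ♯H′ (inj₂ k) ♯H k∈ = ♯H (subst (_∈trn H C) (π-involutive k) (∈trn-~ (~-sym r) k∈))

    renRel : FinRel → FinRel
    renRel = map (Product.map πN πN)

    renRel⁺ : ∀ {E k l} → ⟪ E ⟫ k l → ⟪ renRel E ⟫ (πN k) (πN l)
    renRel⁺ = ∈-map⁺ (Product.map πN πN)

    renRel⁻ : ∀ {E k l} → ⟪ renRel E ⟫ k l → ⟪ E ⟫ (πN k) (πN l)
    renRel⁻ {E} kl∈ with (k , l) , kEl , refl ← ∈-map⁻ (Product.map πN πN) kl∈ =
      subst₂ ⟪ E ⟫ (sym (πN-involutive k)) (sym (πN-involutive l)) kEl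

    renRel⁺′ : ∀ {E k l} → ⟪ E ⟫ (πN k) (πN l) → ⟪ renRel E ⟫ k l
    renRel⁺′ {E} {k} {l} = subst₂ ⟪ renRel E ⟫ (πN-involutive k) (πN-involutive l) ∘ renRel⁺

    renH : History → History
    renH H i = Maybe.map renEvent (H i)

    ∈trn-renH : ∀ H k → (π k ∈trn H) ⇔ (k ∈trn renH H)
    ∈trn-renH H k = mk⇔
      (λ (i , s , e) → i , s , trans (map-renEvent⁺ e) (cong (λ l → just (l , s)) (π-involutive k)))
      (λ (i , s , e) → i , s , map-renEvent⁻ e)

    Hasco-renH : ∀ H k → Hasco H (π k) ⇔ Hasco (renH H) k
    Hasco-renH H k = mk⇔
      (λ (i , e) → i , trans (map-renEvent⁺ e) (cong (λ l → just (l , hasCo)) (π-involutive k)))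
      (λ (i , e) → i , map-renEvent⁻ e)

    -- Provides a partner for every configuration; each invariant at `k` is the original one at the
    -- renamed `k`.
    renC : ExtConfig → ExtConfig
    renC C = record
      { E            = renRel (E C)
      ; H            = renH (H C)
      ; P            = ren (P C)
      ; process      = record
        { ftn-finite  = map πN (proj₁ names) , λ k k∈ → subst (_∈ map πN (proj₁ names)) (πN-involutive k)
                          (∈-map⁺ πN (proj₂ names (πN k) (∈ftn-ren⁻ (P C) wf k∈)))
        ; well-formed = WellFormed-ren (P C) wf
        }
      ; E-equiv      = record
        { sym   = λ r → renRel⁺′ (IsPartialEquivalence.sym (E-equiv C) (renRel⁻ r))
        ; trans = λ r s → renRel⁺′ (IsPartialEquivalence.trans (E-equiv C) (renRel⁻ r) (renRel⁻ s))
        }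
      ; H-finite     = proj₁ (H-finite C) , λ i e He → proj₂ (H-finite C) i _ (map-renEvent⁻ He)
      ; H-injective  = λ e f → H-injective C (map-renEvent⁻ e) (map-renEvent⁻ f)
      ; E-domain     = λ k → mk⇔
          (λ r → to (∈trn-renH (H C) k) (to (E-domain C (π k)) (renRel⁻ r)))
          (λ k∈ → renRel⁺′ (from (E-domain C (π k)) (from (∈trn-renH (H C) k) k∈)))
      ; E-Hasco      = λ k l r →
          mk⇔ (λ h → to (Hasco-renH (H C) l) (to (E-Hasco C (π k) (π l) (renRel⁻ r)) (from (Hasco-renH (H C) k) h)))
              (λ h → to (Hasco-renH (H C) k) (from (E-Hasco C (π k) (π l) (renRel⁻ r)) (from (Hasco-renH (H C) l) h)))
      ; ftn-Hasco    = λ k h k∈ → ftn-Hasco C (π k) (from (Hasco-renH (H C) k) h) (∈ftn-ren⁻ (P C) wf k∈)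
      ; ftn-E        = λ k l r k∈ l∈ → πN-injective
          (ftn-E C (πN k) (πN l) (renRel⁻ r) (∈ftn-ren⁻ (P C) wf k∈) (∈ftn-ren⁻ (P C) wf l∈))
      ; ftn-external = λ k k∈ → to (∈trn-renH (H C) k) (ftn-external C (π k) (∈ftn-ren⁻ (P C) wf k∈))
      }
      where
      names = IsProcess.ftn-finite (process C)
      wf    = IsProcess.well-formed (process C)

    ~-renC : ∀ C → C ~ renC C
    ~-renC C = record
      { P-ren = refl ; E-ren = renRel⁺ ; E-ren⁻ = renRel⁻ ; H-ren = λ _ → refl }

    merge-ren : ∀ {E E′} σ → (∀ {k l} → ⟪ E ⟫ k l → ⟪ E′ ⟫ (πN k) (πN l)) →
      ∀ {k l} → merge σ E k l → merge (renS σ) E′ (πN k) (πN l)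
    merge-ren {E} {E′} σ E→E′ = go
      where
      base : ∀ {σ k l} → ⟪ E ⟫ k l ⊎ (l ∈range σ × (k ≡ l ⊎ k ∈ dom σ)) →
        ⟪ E′ ⟫ (πN k) (πN l) ⊎ (πN l ∈range renS σ × (πN k ≡ πN l ⊎ πN k ∈ dom (renS σ)))
      base (inj₁ kEl)                    = inj₁ (E→E′ kEl)
      base (inj₂ (is-range , inj₁ k≡l)) = inj₂ (is-range , inj₁ (cong πN k≡l))
      base (inj₂ (is-range , inj₂ k∈))  = inj₂ (is-range , inj₂ (∈-map⁺ πN k∈))

      go : ∀ {k l} → merge σ E k l → merge (renS σ) E′ (πN k) (πN l)
      go (forth r)    = forth (base {σ} r)
      go (back r)     = back (base {σ} r)
      go (forth⁺ r m) = forth⁺ (base {σ} r) (go m)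
      go (back⁺ r m)  = back⁺ (base {σ} r) (go m)

    -- Equivariance of extended transitions

    private
      module Step {C D : ExtConfig} (C~D : C ~ D) (C′ : ExtConfig) where
        wf = IsProcess.well-formed (process C)

        step : ∀ {α σ} → P C ─[ α ∣ σ ]→ P C′ → P D ─[ renL α ∣ renS σ ]→ P (renC C′)
        step s rewrite P-ren C~D = step-ren wf s

        reconf : ∀ {β} → P C ─⟪ β ⟫→ P C′ → P D ─⟪ renR β ⟫→ P (renC C′)
        reconf s rewrite P-ren C~D = reconf-ren wf s

        E-same : E C′ ≋ ⟪ E C ⟫ → renRel (E C′) ≋ ⟪ E D ⟫
        E-same e k l = mk⇔
          (λ r → subst₂ ⟪ E D ⟫ (πN-involutive k) (πN-involutive l) (E-ren C~D (to (e _ _) (renRel⁻ r))))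
          (λ r → renRel⁺′ (from (e _ _) (E-ren⁻ C~D r)))

        E-merge : ∀ {σ} → E C′ ≋ merge σ (E C) → renRel (E C′) ≋ merge (renS σ) (E D)
        E-merge {σ} e k l = mk⇔
          (λ r → subst₂ (merge (renS σ) (E D)) (πN-involutive k) (πN-involutive l)
                   (merge-ren σ (E-ren C~D) (to (e _ _) (renRel⁻ r))))
          -- The converse inclusion is `merge-ren` again, now for `renS σ`, whose renaming is `σ`.
          (λ m → renRel⁺′ (from (e _ _) (subst (λ σ → merge σ (E C) (πN k) (πN l)) (renS-involutive σ)
                   (merge-ren (renS σ) (E-ren⁻ C~D) m))))

        H-same : H C′ ≗ H C → renH (H C′) ≗ H D
        H-same e i = trans (cong (Maybe.map renEvent) (e i)) (sym (H-ren C~D i))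

        resolve-ren : ∀ k s e → renEvent (resolve (E C) k s e) ≡ resolve (E D) (πN k) s (renEvent e)
        resolve-ren k s (l , did a)
          -- The two membership tests decide equivalent statements, so `resolve` takes the same
          -- branch on both sides.
          rewrite does-⇔ (mk⇔ (E-ren C~D) (subst₂ ⟪ E C ⟫ (πN-involutive (inj₂ l)) (πN-involutive k) ∘ E-ren⁻ C~D))
                         ((inj₂ l , k) ∈ᴱ? E C) ((πN (inj₂ l) , πN k) ∈ᴱ? E D)
          with (inj₂ (π l) , πN k) ∈ᴱ? E D
        ... | yes _ = refl
        ... | no  _ = refl
        resolve-ren k s (l , hasAb) = refl
        resolve-ren k s (l , hasCo) = refl

        H-resolve : ∀ {s} k → H C′ ≗ ((E C , H C) ∖[ s ] k) → renH (H C′) ≗ ((E D , H D) ∖[ s ] πN k)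
        H-resolve {s} k e i rewrite e i | H-ren C~D i with H C i
        ... | nothing = refl
        ... | just h  = cong just (resolve-ren k s h)

        H-extend : ∀ {k s} → Extends (H C) (k , s) (H C′) → Extends (H D) (π k , s) (renH (H C′))
        H-extend (i , undef , new-i , old) =
            i
          , trans (H-ren C~D i) (cong (Maybe.map renEvent) undef)
          , map-renEvent⁺ new-i
          , λ j j≢i → trans (cong (Maybe.map renEvent) (old j j≢i)) (sym (H-ren C~D j))

        E-extend : ∀ {k} → E C′ ≋ (λ l l′ → ⟪ E C ⟫ l l′ ⊎ (l ≡ inj₂ k × l′ ≡ inj₂ k)) →
          renRel (E C′) ≋ (λ l l′ → ⟪ E D ⟫ l l′ ⊎ (l ≡ inj₂ (π k) × l′ ≡ inj₂ (π k)))
        E-extend {k} e l l′ = mk⇔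
          (λ r → Sum.map (subst₂ ⟪ E D ⟫ (πN-involutive l) (πN-involutive l′) ∘ E-ren C~D)
                         (Product.map unren unren) (to (e _ _) (renRel⁻ r)))
          (λ r → renRel⁺′ (from (e _ _) (Sum.map (E-ren⁻ C~D) (Product.map reren reren) r)))
          where
          unren : ∀ {l} → πN l ≡ inj₂ k → l ≡ inj₂ (π k)
          unren {l} e = trans (sym (πN-involutive l)) (cong πN e)
          reren : ∀ {l} → l ≡ inj₂ (π k) → πN l ≡ inj₂ k
          reren e = trans (cong πN e) (cong inj₂ (π-involutive k))

    -- The source is any partner `D` of `C`, so that a configuration fixed by the renaming may be
    -- its own partner. The target can be the canonical `renC C′`, from which the rest of a path
    -- continues by `~-renC`.
    →ₑ-~ : ∀ {C D} → C ~ D → ∀ {C′ ζ} → C ─[ ζ ]→ₑ C′ → D ─[ renE ζ ]→ₑ renC C′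
    →ₑ-~ {C} {D} C~D {C′} = go
      where
      open Step C~D C′

      go : ∀ {ζ} → C ─[ ζ ]→ₑ C′ → D ─[ renE ζ ]→ₑ renC C′
      go (e-internal s e h)        = e-internal (step s) (E-same e) (H-same h)
      go (e-merge {σ = σ} k s ♯C e h) = e-merge k (step s) (♯Δ-~ C~D (inj₁ k) ♯C) (E-merge {σ} e) (H-same h)
      go (e-new k r ♯C e h)        = e-new k (reconf r) (♯Δ-~ C~D (inj₁ k) ♯C) (E-same e) (H-same h)
      go (e-commit k r e h)        = e-commit (πN k) (reconf r) (E-same e) (H-resolve k h)
      go (e-abort k r e h)         = e-abort (πN k) (reconf r) (E-same e) (H-resolve k h)
      go (e-action {σ = σ} k s ♯C e h) =
        e-action (π k) (step s) (♯Δ-~ C~D (inj₂ k) ♯C) (E-merge {σ} e) (H-extend h)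
      go (e-aborted-action k ♯C k∉ p e h) =
        e-aborted-action (π k) (♯Δ-~ C~D (inj₂ k) ♯C)
          (subst (λ Q → ¬ inj₂ (π k) ∈ftn Q) (sym (P-ren C~D)) (∉ftn-ren (P C) wf k∉))
          (trans (cong ren p) (sym (P-ren C~D))) (E-extend e) (H-extend h)

    ⇒τ-~ : ∀ {C D} → C ~ D → ∀ {C′} → C ⇒τ C′ → ∃[ D′ ] (D ⇒τ D′ × C′ ~ D′)
    ⇒τ-~ r done    = _ , done , r
    ⇒τ-~ r (t ◅ w) with D′ , w′ , r′ ← ⇒τ-~ (~-renC _) w = D′ , →ₑ-~ r t ◅ w′ , r′

    ⇒-~ : ∀ {C D} → C ~ D → ∀ {C′} ζ → C ═[ ζ ]⇒ C′ → ∃[ D′ ] (D ═[ renE ζ ]⇒ D′ × C′ ~ D′)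
    ⇒-~ r τ w = ⇒τ-~ r w
    ⇒-~ r (k ⟨ a ⟩) (_ , _ , w , t , w′)
      with D₁ , v , r₁ ← ⇒τ-~ r w
      with D₂ , v′ , r₂ ← ⇒τ-~ (~-renC _) w′ =
      D₂ , (_ , _ , v , →ₑ-~ r₁ t , v′) , r₂

    -- Equivariance of satisfaction

    value-~ : ∀ {n} {ρ ρ′ : Env n} → (∀ x → ρ′ x ≡ π (ρ x)) →
      ∀ v → NameFreeᵛ v → value ρ′ v ≡ π (value ρ v)
    value-~ ρ′≡ (inj₂ x) _ = ρ′≡ x

    -- Under a diamond the excluded names are renamed as well, and the witness for `l` is the image
    -- of the one for `π l`. Negation reverses direction, which the symmetry of `_~_` absorbs.
    ⊨-~ : ∀ {n} (φ : Formula n) → NameFree φ → ∀ {C D} → C ~ D → ∀ {ρ ρ′} → (∀ x → ρ′ x ≡ π (ρ x)) →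
      C ⊨[ ρ ] φ → D ⊨[ ρ′ ] φ
    ⊨-~ (⟨τ⟩ φ) nf r ρ′≡ (C′ , w , s)
      with D′ , w′ , r′ ← ⇒-~ r τ w = D′ , w′ , ⊨-~ φ nf r′ ρ′≡ s
    ⊨-~ (⟨x a ⟩ φ) nf {C} {D} r {ρ} {ρ′} ρ′≡ (N , f) = map π N , matching
      where
      matching : ∀ l → l ∉ map π N → ∃[ D′ ] (D ═[ l ⟨ a ⟩ ]⇒ D′ × D′ ⊨[ l Vector.∷ ρ′ ] φ)
      matching l l∉
        with C′ , w , s ← f (π l) (λ πl∈ → l∉ (subst (_∈ map π N) (π-involutive l) (∈-map⁺ π πl∈)))
        with D′ , w′ , r′ ← ⇒-~ r (π l ⟨ a ⟩) w =
          D′ , subst (λ h → D ═[ h ⟨ a ⟩ ]⇒ D′) (π-involutive l) w′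
        , ⊨-~ φ nf r′ (λ { zero → sym (π-involutive l) ; (suc x) → ρ′≡ x }) s
    ⊨-~ (¬̇ φ) nf r {ρ} {ρ′} ρ′≡ ¬s s =
      ¬s (⊨-~ φ nf (~-sym r) (λ x → trans (sym (π-involutive (ρ x))) (cong π (sym (ρ′≡ x)))) s)
    ⊨-~ (⋀ K φ) nf r ρ′≡ s i = ⊨-~ (φ i) (nf i) r ρ′≡ (s i)
    ⊨-~ (v =̇co w) (nfv , nfw) {D = D} r ρ′≡ s =
      subst₂ (D ⊨_=co_) (sym (value-~ ρ′≡ v nfv)) (sym (value-~ ρ′≡ w nfw)) (=co-~ r s)

    -- The external names of the process and of `E` all occur in the history, so a renaming that
    -- fixes the names of the history fixes the whole configuration.
    ~-fixed : ∀ C → (∀ k → k ∈trn H C → π k ≡ k) → C ~ C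
    ~-fixed C fix = record
      { P-ren  = sym (ren-fixed (P C) (λ { (inj₁ k) _ → refl
                                         ; (inj₂ k) k∈ → cong inj₂ (fix k (ftn-external C k k∈)) }))
      ; E-ren  = E-fixed
      ; E-ren⁻ = E-fixed
      ; H-ren  = H-fixed
      }
      where
      module E = IsPartialEquivalence (E-equiv C)

      fixN : ∀ k → ⟪ E C ⟫ k k → πN k ≡ k
      fixN (inj₁ k) _   = refl
      fixN (inj₂ k) kEk = cong inj₂ (fix k (to (E-domain C k) kEk))

      E-fixed : ∀ {k l} → ⟪ E C ⟫ k l → ⟪ E C ⟫ (πN k) (πN l)
      E-fixed {k} {l} kEl = subst₂ ⟪ E C ⟫ (sym (fixN k (E.trans kEl (E.sym kEl))))
                                           (sym (fixN l (E.trans (E.sym kEl) kEl))) kEl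

      H-fixed : ∀ i → H C i ≡ Maybe.map renEvent (H C i)
      H-fixed i with H C i in e
      ... | nothing      = refl
      ... | just (k , s) = cong (λ l → just (l , s)) (sym (fix k (i , s , e)))

  -- Transpositions of external names

  swap : ExTrN → ExTrN → ExTrN → ExTrN
  swap k l h with h ≟ₑ k
  ... | yes _ = l
  ... | no  _ with h ≟ₑ l
  ...   | yes _ = k
  ...   | no  _ = h

  swap-fresh : ∀ k l {h} → h ≢ k → h ≢ l → swap k l h ≡ h
  swap-fresh k l {h} h≢k h≢l with h ≟ₑ k
  ... | yes h≡k = contradiction h≡k h≢k
  ... | no  _ with h ≟ₑ l
  ...   | yes h≡l = contradiction h≡l h≢l
  ...   | no  _   = refl

  swap-left : ∀ k l → swap k l k ≡ l
  swap-left k l with k ≟ₑ k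
  ... | yes _   = refl
  ... | no  k≢k = contradiction refl k≢k

  swap-right : ∀ k l → swap k l l ≡ k
  swap-right k l with l ≟ₑ k
  ... | yes l≡k = l≡k
  ... | no  _ with l ≟ₑ l
  ...   | yes _   = refl
  ...   | no  l≢l = contradiction refl l≢l

  swap-involutive : ∀ k l h → swap k l (swap k l h) ≡ h
  swap-involutive k l h = by-cases (h ≟ₑ k) (h ≟ₑ l)
    where
    by-cases : Dec (h ≡ k) → Dec (h ≡ l) → swap k l (swap k l h) ≡ h
    by-cases (yes refl) _          = trans (cong (swap k l) (swap-left k l)) (swap-right k l)
    by-cases (no _)     (yes refl) = trans (cong (swap k l) (swap-right k l)) (swap-left k l)
    by-cases (no h≢k)   (no h≢l)   =
      trans (cong (swap k l) (swap-fresh k l h≢k h≢l)) (swap-fresh k l h≢k h≢l)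

  module Swap (k l : ExTrN) = Renaming (swap k l) (swap-involutive k l)

  -- Names of the history along transitions

  SameNames : Rel History 0ℓ
  SameNames H H′ = ∀ i → Maybe.map proj₁ (H′ i) ≡ Maybe.map proj₁ (H i)

  ∈trn-SameNames : ∀ {H H′ k} → SameNames H H′ → k ∈trn H → k ∈trn H′
  ∈trn-SameNames {H} {H′} same (i , s , e) with H′ i in e′ | trans (same i) (cong (Maybe.map proj₁) e)
  ... | just (k , s′) | refl = i , s′ , e′

  -- Commits and aborts change the status of entries only; the name at each index stays.
  SameNames-step : ∀ {C C′} → C ─[ τ ]→ₑ C′ → SameNames (H C) (H C′)
  SameNames-step {C} {C′} = go
    where
    resolve-name : ∀ E k s m → Maybe.map proj₁ (Maybe.map (resolve E k s) m) ≡ Maybe.map proj₁ m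
    resolve-name E k s nothing = refl
    resolve-name E k s (just (l , did a)) with (inj₂ l , k) ∈ᴱ? E
    ... | yes _ = refl
    ... | no  _ = refl
    resolve-name E k s (just (l , hasAb)) = refl
    resolve-name E k s (just (l , hasCo)) = refl

    go : C ─[ τ ]→ₑ C′ → SameNames (H C) (H C′)
    go (e-internal _ _ h)    i = cong (Maybe.map proj₁) (h i)
    go (e-merge _ _ _ _ h)   i = cong (Maybe.map proj₁) (h i)
    go (e-new _ _ _ _ h)     i = cong (Maybe.map proj₁) (h i)
    go (e-commit k _ _ h)    i = trans (cong (Maybe.map proj₁) (h i)) (resolve-name (E C) k _ (H C i))
    go (e-abort k _ _ h)     i = trans (cong (Maybe.map proj₁) (h i)) (resolve-name (E C) k _ (H C i))

  SameNames-⇒τ : ∀ {C C′} → C ⇒τ C′ → SameNames (H C) (H C′)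
  SameNames-⇒τ done    i = refl
  SameNames-⇒τ (t ◅ w) i = trans (SameNames-⇒τ w i) (SameNames-step t i)

  ∈trn-⇒τ : ∀ {C C′ h} → C ⇒τ C′ → (h ∈trn H C) ⇔ (h ∈trn H C′)
  ∈trn-⇒τ w = mk⇔ (∈trn-SameNames (SameNames-⇒τ w)) (∈trn-SameNames (sym ∘ SameNames-⇒τ w))

  ∈trn-Extends : ∀ {H H′ k s h} → Extends H (k , s) H′ → (h ∈trn H′) ⇔ (h ≡ k ⊎ h ∈trn H)
  ∈trn-Extends {H} {H′} {k} {s} {h} (i , undef , new-i , old) = mk⇔ split join
    where
    split : h ∈trn H′ → h ≡ k ⊎ h ∈trn H
    split (j , t , e) with j ≟ℕ i
    ... | no  j≢i  = inj₂ (j , t , trans (sym (old j j≢i)) e)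
    ... | yes refl with refl ← trans (sym e) new-i = inj₁ refl

    join : h ≡ k ⊎ h ∈trn H → h ∈trn H′
    join (inj₁ refl)        = i , s , new-i
    join (inj₂ (j , t , e)) = j , t , trans (old j λ { refl → case trans (sym e) undef of λ () }) e

  action-names : ∀ {C C′ k a} → C ─[ k ⟨ a ⟩ ]→ₑ C′ →
    ¬ k ∈trn H C × (∀ h → (h ∈trn H C′) ⇔ (h ≡ k ⊎ h ∈trn H C))
  action-names (e-action _ _ (_ , ♯H) _ ext)           = ♯H , λ h → ∈trn-Extends ext
  action-names (e-aborted-action _ (_ , ♯H) _ _ _ ext) = ♯H , λ h → ∈trn-Extends ext

  -- The history gains exactly the name of the label, so an environment that lists its names needs
  -- just one further entry.
  ⇒action-names : ∀ {C C′ k a} → C ═[ k ⟨ a ⟩ ]⇒ C′ →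
    ¬ k ∈trn H C × (∀ h → (h ∈trn H C′) ⇔ (h ≡ k ⊎ h ∈trn H C))
  ⇒action-names (_ , _ , w , t , w′) with k∉ , names ← action-names t =
      k∉ ∘ to (∈trn-⇒τ w)
    , λ h → mk⇔ (Sum.map₂ (from (∈trn-⇒τ w)) ∘ to (names h) ∘ from (∈trn-⇒τ w′))
                (to (∈trn-⇒τ w′) ∘ from (names h) ∘ Sum.map₂ (to (∈trn-⇒τ w)))

  -- Absence from the history suffices for freshness, because `E-domain` and `ftn-external` confine
  -- the external names of `E` and `P` to the history.
  fresh-♯ : ∀ {C k} a → ¬ k ∈trn H C → (k ⟨ a ⟩) ♯ C
  fresh-♯ {C} {k} a k∉ =
      ( (λ { (l , inj₁ kEl) → k∉ (to (E-domain C k) (E.trans kEl (E.sym kEl)))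
           ; (l , inj₂ lEk) → k∉ (to (E-domain C k) (E.trans (E.sym lEk) lEk)) })
      , k∉)
    , k∉ ∘ ftn-external C k
    where module E = IsPartialEquivalence (E-equiv C)

  trnList : ExtConfig → List ExTrN
  trnList C = mapMaybe (Maybe.map proj₁ ∘ H C) (proj₁ (H-finite C))

  ∈-trnList : ∀ {C k} → k ∈trn H C → k ∈ trnList C
  ∈-trnList {C} {k} (i , s , e) =
    mapMaybe⁺ _ _ (lose (∈-map⁺ _ (proj₂ (H-finite C) i _ e)) is-k)
    where
    is-k : MAny.Any (k ≡_) (Maybe.map proj₁ (H C i))
    is-k rewrite e = MAny.just refl

  -- Bisimilarity implies logical equivalence

  Eq-sym : ∀ {C D} → Eq C D → Eq D C
  Eq-sym e k l = ⇔-sym (e k l)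

  converse : ∀ {R} → IsEqBisimulation R → IsEqBisimulation (flip R)
  converse bisim = record
    { eq    = λ {C} {D} r → Eq-sym {D} {C} (IsEqBisimulation.eq bisim r)
    ; forth = IsEqBisimulation.back bisim
    ; back  = IsEqBisimulation.forth bisim
    }

  bisimilar-⊨ : ∀ {R} → IsEqBisimulation R → ∀ {n} (φ : Formula n) {ρ C D} → R C D → C ⊨[ ρ ] φ → D ⊨[ ρ ] φ
  bisimilar-⊨ bisim (⟨τ⟩ φ) r (C′ , w , s)
    with D′ , w′ , r′ ← IsEqBisimulation.forth bisim r w tt = D′ , w′ , bisimilar-⊨ bisim φ r′ s
  -- The names of `D` are excluded too, since `forth` answers only labels that are fresh for `D`.
  bisimilar-⊨ bisim (⟨x a ⟩ φ) {ρ} {C} {D} r (N , f) = N ++ trnList D , matching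
    where
    matching : ∀ l → l ∉ N ++ trnList D → ∃[ D′ ] (D ═[ l ⟨ a ⟩ ]⇒ D′ × D′ ⊨[ l Vector.∷ ρ ] φ)
    matching l l∉
      with C′ , w , s ← f l (l∉ ∘ ∈-++⁺ˡ)
      with D′ , w′ , r′ ← IsEqBisimulation.forth bisim r w (fresh-♯ {D} a (l∉ ∘ ∈-++⁺ʳ N ∘ ∈-trnList {D})) =
        D′ , w′ , bisimilar-⊨ bisim φ r′ s
  bisimilar-⊨ bisim (¬̇ φ) r ¬s s = ¬s (bisimilar-⊨ (converse bisim) φ r s)
  bisimilar-⊨ bisim (⋀ K φ) r s i = bisimilar-⊨ bisim (φ i) r (s i)
  bisimilar-⊨ bisim (v =̇co w) r s = to (IsEqBisimulation.eq bisim r _ _) s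

  -- Indistinguishable configurations

  LogicallyEquivalent : ∀ {n} → Env n → ExtConfig → ExtConfig → Set₁
  LogicallyEquivalent ρ C D = ∀ φ → NameFree φ → (C ⊨[ ρ ] φ) ⇔ (D ⊨[ ρ ] φ)

  Enumerates : ∀ {n} → Env n → ExtConfig → Set
  Enumerates ρ C = ∀ k → (k ∈trn H C) ⇔ (∃[ x ] ρ x ≡ k)

  Indistinguishable : ExtConfig → ExtConfig → Set₁
  Indistinguishable C D =
    ∃[ n ] Σ[ ρ ∈ Env n ] (Enumerates ρ C × Enumerates ρ D × LogicallyEquivalent ρ C D)

  Indistinguishable-sym : ∀ {C D} → Indistinguishable C D → Indistinguishable D C
  Indistinguishable-sym (n , ρ , enC , enD , le) = n , ρ , enD , enC , λ φ nf → ⇔-sym (le φ nf)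

  -- Committed names occur in the history and are therefore values of variables under `ρ`, which
  -- turns the claim into an atom without constants.
  Indistinguishable⇒=co : ∀ {C D} → Indistinguishable C D → ∀ {k l} → C ⊨ k =co l → D ⊨ k =co l
  Indistinguishable⇒=co (n , ρ , enC , _ , le) {k} {l} s@((i , e) , (j , e′) , _)
    with x , refl ← to (enC k) (i , _ , e)
    with y , refl ← to (enC l) (j , _ , e′) = to (le (inj₂ x =̇co inj₂ y) (tt , tt)) s

  Enumerates-⇒τ : ∀ {n} {ρ : Env n} {C C′} → C ⇒τ C′ → Enumerates ρ C → Enumerates ρ C′
  Enumerates-⇒τ w en k = en k ⇔-∘ ⇔-sym (∈trn-⇒τ w)

  Enumerates-⇒action : ∀ {n} {ρ : Env n} {C C′ k a} → C ═[ k ⟨ a ⟩ ]⇒ C′ →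
    Enumerates ρ C → Enumerates (k Vector.∷ ρ) C′
  Enumerates-⇒action w en h = mk⇔
    (λ h∈ → case to (proj₂ (⇒action-names w) h) h∈ of λ where
      (inj₁ h≡k) → zero , sym h≡k
      (inj₂ h∈)  → let x , e = to (en h) h∈ in suc x , e)
    (λ { (zero , e)  → from (proj₂ (⇒action-names w) h) (inj₁ (sym e))
       ; (suc x , e) → from (proj₂ (⇒action-names w) h) (inj₂ (from (en h) (x , e))) })

  -- Diamonds tested at a single fresh name

  swap-Enumerates : ∀ {n} {ρ : Env n} {C} k l → Enumerates ρ C → ¬ k ∈trn H C → ¬ l ∈trn H C →
    Swap._~_ k l C C × (∀ x → swap k l (ρ x) ≡ ρ x)
  swap-Enumerates {C = C} k l en k∉ l∉ =
      Swap.~-fixed k l C fix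
    , λ x → fix _ (from (en _) (x , refl))
    where
    fix : ∀ h → h ∈trn H C → swap k l h ≡ h
    fix h h∈ = swap-fresh k l (λ { refl → k∉ h∈ }) (λ { refl → l∉ h∈ })

  swap-env : ∀ {n} {ρ : Env n} k l → (∀ x → swap k l (ρ x) ≡ ρ x) →
    ∀ x → (l Vector.∷ ρ) x ≡ swap k l ((k Vector.∷ ρ) x)
  swap-env k l fix zero    = sym (swap-left k l)
  swap-env k l fix (suc x) = sym (fix x)

  -- A transition at one name gives transitions at all names outside the history of `C`: transposing
  -- `k` and `l` fixes `C` and `ρ` and moves the witness from `k` to `l`.
  ⊨-diamond-intro : ∀ {n} {ρ : Env n} {C C′ k a} φ → NameFree φ → Enumerates ρ C →
    C ═[ k ⟨ a ⟩ ]⇒ C′ → C′ ⊨[ k Vector.∷ ρ ] φ → C ⊨[ ρ ] (⟨x a ⟩ φ)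
  ⊨-diamond-intro {ρ = ρ} {C} {C′} {k} {a} φ nf en w s = trnList C , matching
    where
    matching : ∀ l → l ∉ trnList C → ∃[ D ] (C ═[ l ⟨ a ⟩ ]⇒ D × D ⊨[ l Vector.∷ ρ ] φ)
    matching l l∉
      with C~C , fix ← swap-Enumerates k l en (proj₁ (⇒action-names w)) (l∉ ∘ ∈-trnList {C})
      with D , w′ , C′~D ← Swap.⇒-~ k l C~C (k ⟨ a ⟩) w =
        D , subst (λ h → C ═[ h ⟨ a ⟩ ]⇒ D) (swap-left k l) w′
      , Swap.⊨-~ k l φ nf C′~D (swap-env k l fix) s

  -- Since Dec carries its witness, em also provides choice of formulae.
  module _ (em : ExcludedMiddle (Level.suc 0ℓ)) where

    em₀ : ExcludedMiddle 0ℓ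
    em₀ {A} = map′ lower lift (em {Lift _ A})

    exists-∉ : ∀ xs → ∃[ l ] (l ∉ xs)
    exists-∉ xs with em₀ {∃[ l ] (l ∉ xs)}
    ... | yes ∃l = ∃l
    -- An injection from the natural numbers cannot have all its values in a finite list.
    ... | no ∄l = contradiction covered (finite ExTrN-infinite xs)
      where
      covered : ∀ i → Injection.to ExTrN-infinite i ∈ xs
      covered i with em₀ {Injection.to ExTrN-infinite i ∈ xs}
      ... | yes f∈ = f∈
      ... | no f∉  = contradiction (_ , f∉) ∄l

    -- The given `k` may be among the excluded names, so the diamond is used at some other fresh `l`
    -- and the witness is transposed back to `k`.
    ⊨-diamond-elim : ∀ {n} {ρ : Env n} {C k a} φ → NameFree φ → Enumerates ρ C → ¬ k ∈trn H C →
      C ⊨[ ρ ] (⟨x a ⟩ φ) → ∃[ C′ ] (C ═[ k ⟨ a ⟩ ]⇒ C′ × C′ ⊨[ k Vector.∷ ρ ] φ)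
    ⊨-diamond-elim {C = C} {k} {a} φ nf en k∉ (N , f)
      with l , l∉ ← exists-∉ (N ++ trnList C)
      with C′ , w , s ← f l (l∉ ∘ ∈-++⁺ˡ)
      with C~C , fix ← swap-Enumerates l k en (l∉ ∘ ∈-++⁺ʳ N ∘ ∈-trnList {C}) k∉
      with D , w′ , C′~D ← Swap.⇒-~ l k C~C (l ⟨ a ⟩) w =
        D , subst (λ h → C ═[ h ⟨ a ⟩ ]⇒ D) (swap-left l k) w′
      , Swap.⊨-~ l k φ nf C′~D (swap-env l k fix) s

    -- Separating formulae and logical equivalence as a bisimulation

    Distinguishes : ∀ {n} → Env n → ExtConfig → ExtConfig → Formula n → Set
    Distinguishes ρ C D φ = NameFree φ × C ⊨[ ρ ] φ × ¬ D ⊨[ ρ ] φ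

    -- A failure of equivalence may separate in either direction; a formula that holds only at `D`
    -- is replaced by its negation, so the result always holds at `C`.
    distinguish : ∀ {n} (ρ : Env n) C D → ¬ LogicallyEquivalent ρ C D → ∃[ φ ] Distinguishes ρ C D φ
    distinguish ρ C D ¬le with em {∃[ φ ] Distinguishes ρ C D φ}
    ... | yes ∃φ = ∃φ
    ... | no ∄φ  = contradiction (λ φ nf → mk⇔ (C⇒D φ nf) (D⇒C φ nf)) ¬le
      where
      C⇒D : ∀ φ → NameFree φ → C ⊨[ ρ ] φ → D ⊨[ ρ ] φ
      C⇒D φ nf s with em₀ {D ⊨[ ρ ] φ}
      ... | yes s′ = s′
      ... | no ¬s′ = contradiction (φ , nf , s , ¬s′) ∄φ

      D⇒C : ∀ φ → NameFree φ → D ⊨[ ρ ] φ → C ⊨[ ρ ] φ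
      D⇒C φ nf s with em₀ {C ⊨[ ρ ] φ}
      ... | yes s′ = s′
      ... | no ¬s′ = contradiction (¬̇ φ , nf , ¬s′ , λ ¬s → ¬s s) ∄φ

    -- If every member of `A` were separated from `C`, the conjunction of the separating formulae
    -- would hold at `C` and hence at some member, contradicting that member's own conjunct. The
    -- members themselves index the conjunction, so `A` may be infinite.
    equivalent-member : ∀ {n} (ρ : Env n) C (A : ExtConfig → Set) →
      (∀ φ → NameFree φ → C ⊨[ ρ ] φ → ∃[ D ] (A D × D ⊨[ ρ ] φ)) →
      ∃[ D ] (A D × LogicallyEquivalent ρ C D)
    equivalent-member ρ C A realised with em {∃[ D ] (A D × LogicallyEquivalent ρ C D)}
    ... | yes ∃D = ∃D
    ... | no ∄D  =
      let D , D∈ , s = realised (⋀ (∃[ D ] A D) (proj₁ ∘ φ)) (proj₁ ∘ proj₂ ∘ φ) (proj₁ ∘ proj₂ ∘ proj₂ ∘ φ)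
      in contradiction (s (D , D∈)) (proj₂ (proj₂ (proj₂ (φ (D , D∈)))))
      where
      φ : ((D , _) : ∃[ D ] A D) → ∃[ φ ] Distinguishes ρ C D φ
      φ (D , D∈) = distinguish ρ C D (λ le → ∄D (D , D∈ , le))

    -- The candidates are the weak successors of `D` under `ζ`. A formula true at `C′` puts a
    -- diamond on `C`, and equivalence with `D` then yields a candidate that satisfies it.
    Indistinguishable-forth : ∀ {C D C′} → Indistinguishable C D → ∀ ζ → C ═[ ζ ]⇒ C′ → ζ ♯ D →
      ∃[ D′ ] (D ═[ ζ ]⇒ D′ × Indistinguishable C′ D′)
    Indistinguishable-forth {C} {D} {C′} (n , ρ , enC , enD , le) τ w _ =
      let D′ , w′ , le′ = equivalent-member ρ C′ (D ⇒τ_) (λ φ nf s → to (le (⟨τ⟩ φ) nf) (C′ , w , s))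
      in D′ , w′ , n , ρ , Enumerates-⇒τ w enC , Enumerates-⇒τ w′ enD , le′
    Indistinguishable-forth {C} {D} {C′} (n , ρ , enC , enD , le) (k ⟨ a ⟩) w ((_ , k∉) , _) =
      let D′ , w′ , le′ = equivalent-member (k Vector.∷ ρ) C′ (D ═[ k ⟨ a ⟩ ]⇒_)
            (λ φ nf s → ⊨-diamond-elim φ nf enD k∉
                          (to (le (⟨x a ⟩ φ) nf) (⊨-diamond-intro φ nf enC w s)))
      in D′ , w′ , ℕ.suc n , k Vector.∷ ρ , Enumerates-⇒action w enC , Enumerates-⇒action w′ enD , le′

    -- Bisimulations live in Set and Indistinguishable in Set₁; deciding it
    -- classically lowers the level.
    R : Rel ExtConfig 0ℓ
    R C D = True (em {Indistinguishable C D})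

    R-isEqBisimulation : IsEqBisimulation R
    R-isEqBisimulation = record
      { eq    = λ r k l → mk⇔ (Indistinguishable⇒=co (toWitness r))
                              (Indistinguishable⇒=co (Indistinguishable-sym (toWitness r)))
      ; forth = λ {_} {_} {_} {ζ} r w ζ♯ →
          let D′ , w′ , i = Indistinguishable-forth (toWitness r) ζ w ζ♯
          in D′ , w′ , fromWitness i
      ; back  = λ {_} {_} {_} {ζ} r w ζ♯ →
          let C′ , w′ , i = Indistinguishable-forth (Indistinguishable-sym (toWitness r)) ζ w ζ♯
          in C′ , w′ , fromWitness (Indistinguishable-sym i)
      }

    𝓛Eq-≐⇒≈Eqₚ : ∀ P Q → 𝓛Eq P ≐ 𝓛Eq Q → P ≈Eqₚ Q
    𝓛Eq-≐⇒≈Eqₚ P Q (P⊆Q , Q⊆P) =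
        R , R-isEqBisimulation
      -- Initial histories are empty, so the empty environment lists their names, and equality of
      -- the theories applies in particular to formulae without constants.
      , fromWitness (0 , Vector.[] , none , none , λ φ _ → mk⇔ P⊆Q Q⊆P)
      where
      none : ∀ k → (k ∈trn (λ _ → nothing)) ⇔ (∃[ x ] Vector.[] x ≡ k)
      none k = mk⇔ (λ ()) (λ ())

  ≈Eqₚ⇒𝓛Eq-≐ : ∀ P Q → P ≈Eqₚ Q → 𝓛Eq P ≐ 𝓛Eq Q
  ≈Eqₚ⇒𝓛Eq-≐ P Q (R , bisim , r) =
    (λ {φ} → bisimilar-⊨ bisim φ r) , (λ {φ} → bisimilar-⊨ (converse bisim) φ r)

open Level using (suc)

proposition4p10 : ExcludedMiddle (suc 0ℓ) → (S : Signature) → let open TCCS S in (P Q : Process) → (P ≈Eqₚ Q) ⇔ (𝓛Eq P ≐ 𝓛Eq Q)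
proposition4p10 em S P Q = mk⇔ (≈Eqₚ⇒𝓛Eq-≐ P Q) (𝓛Eq-≐⇒≈Eqₚ em P Q)
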